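{- For any integer $n\geq 1$, the continuous edge chromatic number of the Schreier graph $F(2^{\mathbb{Z}^n})$ (with respect to the standard generating set of $\mathbb{Z}^n$) is $\chi'_c(F(2^{\mathbb{Z}^n}))=2n+1$.
   Context: The standard generating set of $\mathbb{Z}^n$ is $\{\pm e_i: 1\leq i\leq n\}$, where $e_i$ has $i$-th coordinate $1$ and all other coordinates $0$. Bernoulli shift: $2^{\mathbb{Z}^n}=\{0,1\}^{\mathbb{Z}^n}$ has the product topology, and $\mathbb{Z}^n$ acts on it by $(g\cdot x)(h)=x(h+g)$. The free part is $F(2^{\mathbb{Z}^n})=\{x\in 2^{\mathbb{Z}^n}: g\cdot x\neq x \text{ for all } g\neq \bar 0\}$, with the subspace topology. The same symbol $F(2^{\mathbb{Z}^n})$ denotes the Schreier graph on this vertex set: $x,y$ are joined by an edge iff $y=\pm e_i\cdot x$ for some $i$ and some choice of sign. A proper edge $\kappa$-coloring of a graph $G$ is a map $c:E(G)\to\kappa$ such that distinct edges sharing a vertex receive distinct values. An edge coloring $c$ of $F(2^{\mathbb{Z}^n})$ with values in a discrete set $\kappa$ is continuous if for each generator $s=\pm e_i$ the map $x\mapsto c(x,s\cdot x)$ is continuous on $F(2^{\mathbb{Z}^n})$. $\chi'_c$ is the least cardinality of a (discrete) set $\kappa$ for which a continuous proper edge $\kappa$-coloring exists. -}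

module Defs where

open import Data.Bool.Base using (Bool)
open import Data.Fin.Base using (Fin)
open import Data.Integer.Base as ℤ using (ℤ; 0ℤ; 1ℤ)
import Data.Integer.Properties as ℤ
open import Data.List.Base using (List)
open import Data.List.Relation.Unary.All using (All)
open import Data.Nat.Base using (ℕ)
open import Data.Product.Base using (Σ; Σ-syntax; ∃-syntax; _×_; _,_; proj₁; proj₂)
open import Data.Sum.Base using (_⊎_; inj₁; inj₂)
open import Data.Vec.Base using (Vec; map; zipWith; replicate; lookup; _[_]≔_)
open import Data.Vec.Properties
open import Function.Base using (_∘_)
open import Function.Bundles using (_⇔_; _↣_)
open import Level using (0ℓ)
open import Relation.Binary.Bundles using (Setoid)
open import Relation.Binary.Core using (Rel)
open import Relation.Binary.Definitions using (Symmetric; _Respects₂_)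
open import Relation.Binary.PropositionalEquality
open import Relation.Nullary using (¬_)
open import Relation.Unary using (Pred)

open ≡-Reasoning

------------------------------------------------------------------------
-- Graphs and proper edge colorings

-- The vertices form a setoid because points of 2^(ℤⁿ) are functions,
-- which are compared pointwise.
record Graph : Set₁ where
  field
    vertices : Setoid 0ℓ 0ℓ
  open Setoid vertices public using (_≈_) renaming (Carrier to Vertex)
  field
    Adj        : Rel Vertex 0ℓ
    adj-resp   : Adj Respects₂ _≈_
    adj-sym    : Symmetric Adj
    adj-irrefl : ∀ {x y} → x ≈ y → ¬ Adj x y

module _ (G : Graph) where
  open Graph G

  -- (x , y , _) stands for the unordered edge {x, y}; see _≈ᴱ_.
  Edge : Set
  Edge = Σ[ x ∈ Vertex ] Σ[ y ∈ Vertex ] Adj x y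

  _≈ᴱ_ : Rel Edge 0ℓ
  (x , y , _) ≈ᴱ (x′ , y′ , _) = (x ≈ x′ × y ≈ y′) ⊎ (x ≈ y′ × y ≈ x′)

  _isEndOf_ : Vertex → Edge → Set
  v isEndOf (x , y , _) = v ≈ x ⊎ v ≈ y

  record EdgeColoring (κ : Set) : Set where
    field
      color      : Edge → κ
      color-cong : ∀ {e e′} → e ≈ᴱ e′ → color e ≡ color e′

  IsProper : ∀ {κ} → EdgeColoring κ → Set
  IsProper c = ∀ e e′ → ¬ (e ≈ᴱ e′) → (∃[ v ] v isEndOf e × v isEndOf e′) →
               color e ≢ color e′
    where open EdgeColoring c

------------------------------------------------------------------------
-- The group ℤⁿ with its standard generating set

ℤ^ : ℕ → Set
ℤ^ n = Vec ℤ n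

module _ {n : ℕ} where

  infixl 6 _+ᵛ_

  _+ᵛ_ : ℤ^ n → ℤ^ n → ℤ^ n
  _+ᵛ_ = zipWith ℤ._+_

  -ᵛ_ : ℤ^ n → ℤ^ n
  -ᵛ_ = map (ℤ.-_)

  0ᵛ : ℤ^ n
  0ᵛ = replicate n 0ℤ

  e : Fin n → ℤ^ n
  e i = 0ᵛ [ i ]≔ 1ℤ

  IsGenerator : ℤ^ n → Set
  IsGenerator s = ∃[ i ] (s ≡ e i ⊎ s ≡ -ᵛ e i)

  +ᵛ-assoc : ∀ g h k → (g +ᵛ h) +ᵛ k ≡ g +ᵛ (h +ᵛ k)
  +ᵛ-assoc = zipWith-assoc ℤ.+-assoc

  +ᵛ-comm : ∀ g h → g +ᵛ h ≡ h +ᵛ g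
  +ᵛ-comm = zipWith-comm ℤ.+-comm

  g-s+s : ∀ g s → (g +ᵛ (-ᵛ s)) +ᵛ s ≡ g
  g-s+s g s = begin
    (g +ᵛ (-ᵛ s)) +ᵛ s  ≡⟨ +ᵛ-assoc g (-ᵛ s) s ⟩
    g +ᵛ ((-ᵛ s) +ᵛ s)  ≡⟨ cong (g +ᵛ_) (zipWith-inverseˡ ℤ.+-inverseˡ s) ⟩
    g +ᵛ 0ᵛ             ≡⟨ zipWith-identityʳ ℤ.+-identityʳ g ⟩
    g                   ∎

  -ᵛ-involutive : ∀ g → -ᵛ (-ᵛ g) ≡ g
  -ᵛ-involutive g = begin
    map (ℤ.-_) (map (ℤ.-_) g)   ≡⟨ map-∘ ℤ.-_ ℤ.-_ g ⟨
    map (ℤ.-_ ∘ ℤ.-_) g         ≡⟨ map-cong ℤ.neg-involutive g ⟩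
    map (λ z → z) g             ≡⟨ map-id g ⟩
    g                           ∎

  generator-neg : ∀ {s} → IsGenerator s → IsGenerator (-ᵛ s)
  generator-neg (i , inj₁ refl) = i , inj₂ refl
  generator-neg (i , inj₂ refl) = i , inj₁ (-ᵛ-involutive (e i))

  generator≢0 : ∀ {s} → IsGenerator s → s ≢ 0ᵛ
  generator≢0 (i , inj₁ refl) eq with () ← begin
    1ℤ              ≡⟨ lookup∘update i 0ᵛ 1ℤ ⟨
    lookup (e i) i  ≡⟨ cong (λ v → lookup v i) eq ⟩
    lookup 0ᵛ i     ≡⟨ lookup-replicate i 0ℤ ⟩
    0ℤ              ∎
  generator≢0 (i , inj₂ refl) eq with () ← begin
    ℤ.- 1ℤ               ≡⟨ cong ℤ.-_ (lookup∘update i 0ᵛ 1ℤ) ⟨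
    ℤ.- lookup (e i) i   ≡⟨ lookup-map i ℤ.-_ (e i) ⟨
    lookup (-ᵛ e i) i    ≡⟨ cong (λ v → lookup v i) eq ⟩
    lookup 0ᵛ i          ≡⟨ lookup-replicate i 0ℤ ⟩
    0ℤ                   ∎

------------------------------------------------------------------------
-- The Bernoulli shift 2^(ℤⁿ) and its free part

2^ℤ^ : ℕ → Set
2^ℤ^ n = ℤ^ n → Bool

module _ {n : ℕ} where

  infixr 7 _·_

  _·_ : ℤ^ n → 2^ℤ^ n → 2^ℤ^ n
  (g · x) h = x (h +ᵛ g)

  IsFree : 2^ℤ^ n → Set
  IsFree x = ∀ g → g ≢ 0ᵛ → ¬ (g · x ≗ x)

  -- Product topology: every point of U has a basic open neighbourhood,
  -- given by finitely many coordinates, that lies in U.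
  IsOpen : Pred (2^ℤ^ n) 0ℓ → Set
  IsOpen U = ∀ x → U x → Σ[ W ∈ List (ℤ^ n) ]
             (∀ y → All (λ h → y h ≡ x h) W → U y)

F : ℕ → Set
F n = Σ (2^ℤ^ n) IsFree

module _ {n : ℕ} where

  infixr 7 _·ᶠ_
  infix  4 _≗ᶠ_

  _≗ᶠ_ : Rel (F n) 0ℓ
  x ≗ᶠ y = proj₁ x ≗ proj₁ y

  -- The free part is invariant under the action.
  _·ᶠ_ : ℤ^ n → F n → F n
  s ·ᶠ (x , free) = s · x , λ g g≢0 eq → free g g≢0 λ h → begin
    x (h +ᵛ g)                        ≡⟨ cong (λ k → x (k +ᵛ g)) (g-s+s h s) ⟨
    x (((h +ᵛ (-ᵛ s)) +ᵛ s) +ᵛ g)     ≡⟨ cong x (swap (h +ᵛ (-ᵛ s)) s g) ⟩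
    x (((h +ᵛ (-ᵛ s)) +ᵛ g) +ᵛ s)     ≡⟨ eq (h +ᵛ (-ᵛ s)) ⟩
    x ((h +ᵛ (-ᵛ s)) +ᵛ s)            ≡⟨ cong x (g-s+s h s) ⟩
    x h                               ∎
    where
    swap : ∀ (a b c : ℤ^ n) → (a +ᵛ b) +ᵛ c ≡ (a +ᵛ c) +ᵛ b
    swap a b c = trans (+ᵛ-assoc a b c)
                (trans (cong (a +ᵛ_) (+ᵛ-comm b c)) (sym (+ᵛ-assoc a c b)))

  -- Subspace topology
  IsOpenᶠ : Pred (F n) 0ℓ → Set₁
  IsOpenᶠ V = Σ[ U ∈ Pred (2^ℤ^ n) 0ℓ ] IsOpen U × (∀ x → V x ⇔ U (proj₁ x))

  -- Continuity into a discrete space: every subset of κ is open.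
  IsContinuous : {κ : Set} → (F n → κ) → Set₁
  IsContinuous {κ} f = (P : Pred κ 0ℓ) → IsOpenᶠ (P ∘ f)

------------------------------------------------------------------------
-- The Schreier graph on the free part

  SchreierAdj : Rel (F n) 0ℓ
  SchreierAdj x y = ∃[ s ] IsGenerator s × y ≗ᶠ s ·ᶠ x

Schreier : ℕ → Graph
Schreier n = record
  { vertices = record
    { Carrier = F n
    ; _≈_ = _≗ᶠ_
    ; isEquivalence = record
      { refl  = λ _ → refl
      ; sym   = λ p h → sym (p h)
      ; trans = λ p q h → trans (p h) (q h)
      }
    }
  ; Adj = SchreierAdj
  ; adj-resp =
      (λ y≈y′ (s , gen , p) → s , gen , λ h → trans (sym (y≈y′ h)) (p h))
    , (λ x≈x′ (s , gen , p) → s , gen , λ h → trans (p h) (x≈x′ (h +ᵛ s)))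
  ; adj-sym = λ {x} {y} (s , gen , p) → -ᵛ s , generator-neg gen , λ h →
      sym (trans (p (h +ᵛ (-ᵛ s))) (cong (proj₁ x) (g-s+s h s)))
  ; adj-irrefl = λ {x} {y} x≈y (s , gen , p) →
      proj₂ x s (generator≢0 gen) λ h → sym (trans (x≈y h) (p h))
  }

module _ {n : ℕ} where

  edge : (s : ℤ^ n) → IsGenerator s → F n → Edge (Schreier n)
  edge s gen x = x , s ·ᶠ x , s , gen , λ _ → refl

  IsContinuousColoring : {κ : Set} → EdgeColoring (Schreier n) κ → Set₁
  IsContinuousColoring c = ∀ s (gen : IsGenerator s) →
                           IsContinuous (λ x → color (edge s gen x))
    where open EdgeColoring c

HasContinuousProperEdgeColoring : ℕ → Set → Set₁
HasContinuousProperEdgeColoring n κ =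
  Σ[ c ∈ EdgeColoring (Schreier n) κ ]
    IsProper (Schreier n) c × IsContinuousColoring c

-- χ′c[F n ]≡ m : the least cardinality of a set κ admitting a continuous
-- proper edge κ-coloring of the Schreier graph is the finite cardinal m.
-- Here κ ranges over all sets, and |Fin m| ≤ |κ| means there is an
-- injection Fin m ↣ κ.
--
-- The theorem about this value assumes ExcludedMiddle: the definitions here
-- (freeness by negation, pointwise continuity on a Cantor-type space) are
-- the classical ones, and are to be read in classical logic.
χ′c[F_]≡_ : ℕ → ℕ → Set₁
χ′c[F n ]≡ m =
    HasContinuousProperEdgeColoring n (Fin m)
  × (∀ (κ : Set) → HasContinuousProperEdgeColoring n κ → Fin m ↣ κ)

{-# OPTIONS --safe #-}
module Submission where

-- Upper bound. Mark a set of edges which form a matching and which meet every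
-- line in direction i at bounded gaps. Marked edges get one extra color, and
-- between two marked edges a line in direction i alternates between two
-- colors reserved for i. The marked edges are a locally constant maximal
-- independent set for a conflict relation that keeps marked edges on one line
-- far apart, marked edges in different directions disjoint, and nearby
-- parallel marked edges out of line; two applications of the pigeonhole
-- principle show that such conflicts cannot block a long segment of a line.
--
-- Lower bound. If 2n colors appear, every color class on an orbit is a perfect
-- matching. On the orbit of a hyperaperiodic point, whose closure is compact,
-- the matching is read off a window of fixed size. The point used here is
-- recurrent along each axis with arbitrarily large odd periods, so the
-- matching descends to a perfect matching of a torus with an odd number of
-- vertices.

open import Defs
import Data.Integer.Properties as ℤ
import Data.Nat.Properties as ℕ
import Data.Bool.Properties as Bool
open import Algebra.Bundles using (CommutativeRing)
open import Algebra.Properties.AbelianGroup ℤ.+-0-abelianGroup using (∙-cancelʳ)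
open import Algebra.Properties.CommutativeMonoid.Sum ℕ.+-0-commutativeMonoid using (sum; sum-permute; sum-cong-≗; ∑-distrib-+)
open import Algebra.Properties.CommutativeSemigroup (CommutativeRing.+-commutativeSemigroup Bool.xor-∧-commutativeRing) using (interchange)
open import Axiom.ExcludedMiddle using (ExcludedMiddle)
open import Data.Bool.Base using (Bool; true; false; not; _xor_; if_then_else_)
open import Data.Empty using (⊥)
open import Data.Fin.Base using (Fin; zero; suc; toℕ; fromℕ; fromℕ<; inject₁; combine; remQuot)
open import Data.Fin.Permutation using (permutation)
import Data.Fin.Properties as Fin
open import Data.Fin.Relation.Unary.Top using (view; ‵fromℕ; ‵inject₁; view-fromℕ; view-inject₁)
open import Data.Integer.Base as ℤ using (ℤ; +_; -[1+_]; 0ℤ; 1ℤ; -1ℤ; ∣_∣)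
open import Data.Integer.DivMod using (_/ℕ_; _%ℕ_; a≡a%ℕn+[a/ℕn]*n; n%ℕd<d)
open import Data.Integer.Tactic.RingSolver using (solve-∀)
open import Data.List.Base as List using (List; []; _∷_; upTo; _++_)
open import Data.List.Membership.Propositional using (_∈_)
open import Data.List.Membership.Propositional.Properties using (∈-upTo⁺; ∈-map⁺; ∈-++⁺ˡ; ∈-++⁺ʳ; ∈-cartesianProductWith⁺)
import Data.List.Properties as List
open import Data.List.Relation.Unary.All as All using (All; []; _∷_)
open import Data.List.Relation.Unary.Any using (here; there)
open import Data.Nat.Base using (ℕ; zero; suc; _+_; _*_; _^_; _∸_; _⊔_; _≤_; _<_; _≥_; z≤n; s≤s)
open import Data.Nat.Binary.Base as ℕᵇ using (ℕᵇ; zero; 2[1+_]; 1+[2_])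
import Data.Nat.Binary.Properties as ℕᵇ
open import Data.Nat.Induction using (<-rec)
import Data.Nat.Tactic.RingSolver as ℕ-Solver
open import Data.Product.Base using (Σ; Σ-syntax; _×_; _,_; proj₁; proj₂)
open import Data.Product.Function.NonDependent.Propositional using (_×-↔_)
import Data.Product.Properties as Product
open import Data.Sign.Base using (Sign)
open import Data.Sum.Base using (_⊎_; inj₁; inj₂)
open import Data.Sum.Function.Propositional using (_⊎-↔_)
open import Data.Unit.Base using (⊤; tt)
open import Data.Vec.Base as Vec using (Vec; []; _∷_; lookup; updateAt; _[_]≔_)
open import Data.Vec.Properties as Vec using (lookup∘update; lookup∘update′; lookup-replicate; lookup-zipWith; lookup-map; lookup∘updateAt; updateAt-updateAt; updateAt-id-local; zipWith-identityˡ; zipWith-identityʳ; zipWith-inverseˡ; zipWith-inverseʳ)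
open import Function.Base using (_∘_)
open import Function.Bundles using (mk⇔; Equivalence; _↔_; Inverse; mk↔ₛ′; _↣_; mk↣)
open import Function.Construct.Composition using (_↔-∘_)
open import Function.Construct.Identity using (↔-id)
open import Function.Construct.Symmetry using (↔-sym)
open import Level using (0ℓ)
open import Relation.Binary.Definitions using (tri<; tri≈; tri>)
open import Relation.Binary.PropositionalEquality
open import Relation.Nullary using (¬_; contradiction; Dec; yes; no; does)
open import Relation.Nullary.Decidable using (does-⇔; dec-true; dec-false; decidable-stable)

-- The lattice ℤⁿ

-- An arbitrary maximal matching would not do: marked edges in other directions could touch every
-- vertex of a line and keep the whole line unmarked. The conflict `para` lets each other direction
-- touch a short stretch of the line by one marked edge only. It also creates a new way to be
-- blocked, from a parallel line; but only boundedly many parallel lines are near, and being blocked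
-- twice from the same one would put two marked edges on it within distance `K`, against `line`.
-- Local constancy survives the greedy choice because priorities are natural numbers: a decision
-- rests on chains of decreasing priorities, each link of bounded length.
--
-- In the lower bound a free point has no period, so the torus cannot be a quotient of its orbit. It
-- is enough that opposite faces of one box look alike through the window, which recurrence near the
-- origin provides. Base 5 makes the side of the box odd, and squares modulo 5 make the point
-- uniformly aperiodic.

+ᵛ-identityʳ : ∀ {n} (g : ℤ^ n) → g +ᵛ 0ᵛ ≡ g
+ᵛ-identityʳ = zipWith-identityʳ ℤ.+-identityʳ

+ᵛ-identityˡ : ∀ {n} (g : ℤ^ n) → 0ᵛ +ᵛ g ≡ g
+ᵛ-identityˡ = zipWith-identityˡ ℤ.+-identityˡ

+ᵛ-inverseʳ : ∀ {n} (g : ℤ^ n) → g +ᵛ (-ᵛ g) ≡ 0ᵛ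
+ᵛ-inverseʳ = zipWith-inverseʳ ℤ.+-inverseʳ

+ᵛ-inverseˡ : ∀ {n} (g : ℤ^ n) → (-ᵛ g) +ᵛ g ≡ 0ᵛ
+ᵛ-inverseˡ = zipWith-inverseˡ ℤ.+-inverseˡ

+ᵛ-interchange : ∀ {n} (a b c d : ℤ^ n) → (a +ᵛ b) +ᵛ (c +ᵛ d) ≡ (a +ᵛ c) +ᵛ (b +ᵛ d)
+ᵛ-interchange a b c d = begin
  (a +ᵛ b) +ᵛ (c +ᵛ d)  ≡⟨ +ᵛ-assoc a b _ ⟩
  a +ᵛ (b +ᵛ (c +ᵛ d))  ≡⟨ cong (a +ᵛ_) (+ᵛ-assoc b c d) ⟨
  a +ᵛ ((b +ᵛ c) +ᵛ d)  ≡⟨ cong (λ v → a +ᵛ (v +ᵛ d)) (+ᵛ-comm b c) ⟩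
  a +ᵛ ((c +ᵛ b) +ᵛ d)  ≡⟨ cong (a +ᵛ_) (+ᵛ-assoc c b d) ⟩
  a +ᵛ (c +ᵛ (b +ᵛ d))  ≡⟨ +ᵛ-assoc a c _ ⟨
  (a +ᵛ c) +ᵛ (b +ᵛ d)  ∎
  where open ≡-Reasoning

+ᵛ-cancelʳ : ∀ {n} (g h k : ℤ^ n) → g +ᵛ k ≡ h +ᵛ k → g ≡ h
+ᵛ-cancelʳ g h k eq = begin
  g                    ≡⟨ +ᵛ-identityʳ g ⟨
  g +ᵛ 0ᵛ              ≡⟨ cong (g +ᵛ_) (+ᵛ-inverseʳ k) ⟨
  g +ᵛ (k +ᵛ (-ᵛ k))   ≡⟨ +ᵛ-assoc g k _ ⟨
  (g +ᵛ k) +ᵛ (-ᵛ k)   ≡⟨ cong (_+ᵛ (-ᵛ k)) eq ⟩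
  (h +ᵛ k) +ᵛ (-ᵛ k)   ≡⟨ +ᵛ-assoc h k _ ⟩
  h +ᵛ (k +ᵛ (-ᵛ k))   ≡⟨ cong (h +ᵛ_) (+ᵛ-inverseʳ k) ⟩
  h +ᵛ 0ᵛ              ≡⟨ +ᵛ-identityʳ h ⟩
  h                    ∎
  where open ≡-Reasoning

axis : ∀ {n} → Fin n → ℤ → ℤ^ n
axis i t = 0ᵛ [ i ]≔ t

lookup-axis : ∀ {n} (i : Fin n) t → lookup (axis i t) i ≡ t
lookup-axis i t = lookup∘update i 0ᵛ t

lookup-axis′ : ∀ {n} {i j : Fin n} → j ≢ i → ∀ t → lookup (axis i t) j ≡ 0ℤ
lookup-axis′ {j = j} j≢i t = trans (lookup∘update′ j≢i 0ᵛ t) (lookup-replicate j 0ℤ)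

axis-+ : ∀ {n} (i : Fin n) s t → axis i s +ᵛ axis i t ≡ axis i (s ℤ.+ t)
axis-+ zero    s t = cong (_ ∷_) (+ᵛ-identityʳ 0ᵛ)
axis-+ (suc i) s t = cong (0ℤ ∷_) (axis-+ i s t)

axis-0 : ∀ {n} (i : Fin n) → axis i 0ℤ ≡ 0ᵛ
axis-0 zero    = refl
axis-0 (suc i) = cong (0ℤ ∷_) (axis-0 i)

axis-neg : ∀ {n} (i : Fin n) t → -ᵛ axis i t ≡ axis i (ℤ.- t)
axis-neg i t = +ᵛ-cancelʳ _ _ (axis i t) (begin
  (-ᵛ axis i t) +ᵛ axis i t        ≡⟨ +ᵛ-inverseˡ (axis i t) ⟩
  0ᵛ                               ≡⟨ axis-0 i ⟨
  axis i 0ℤ                        ≡⟨ cong (axis i) (ℤ.+-inverseˡ t) ⟨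
  axis i (ℤ.- t ℤ.+ t)             ≡⟨ axis-+ i (ℤ.- t) t ⟨
  axis i (ℤ.- t) +ᵛ axis i t       ∎)
  where open ≡-Reasoning

neg-+ᵛ : ∀ {n} (g h : ℤ^ n) → -ᵛ (g +ᵛ h) ≡ (-ᵛ g) +ᵛ (-ᵛ h)
neg-+ᵛ []      []      = refl
neg-+ᵛ (a ∷ g) (b ∷ h) = cong₂ _∷_ (ℤ.neg-distrib-+ a b) (neg-+ᵛ g h)

∥_∥ : ∀ {n} → ℤ^ n → ℕ
∥ []    ∥ = 0
∥ z ∷ v ∥ = ∣ z ∣ ⊔ ∥ v ∥

∥∥-triangle : ∀ {n} (g h : ℤ^ n) → ∥ g +ᵛ h ∥ ≤ ∥ g ∥ + ∥ h ∥
∥∥-triangle []      []      = z≤n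
∥∥-triangle (a ∷ g) (b ∷ h) = ℕ.⊔-lub
  (ℕ.≤-trans (ℤ.∣i+j∣≤∣i∣+∣j∣ a b) (ℕ.+-mono-≤ (ℕ.m≤m⊔n ∣ a ∣ ∥ g ∥) (ℕ.m≤m⊔n ∣ b ∣ ∥ h ∥)))
  (ℕ.≤-trans (∥∥-triangle g h) (ℕ.+-mono-≤ (ℕ.m≤n⊔m ∣ a ∣ ∥ g ∥) (ℕ.m≤n⊔m ∣ b ∣ ∥ h ∥)))

∥0ᵛ∥ : ∀ n → ∥ 0ᵛ {n} ∥ ≡ 0
∥0ᵛ∥ zero    = refl
∥0ᵛ∥ (suc n) = ∥0ᵛ∥ n

∥axis∥ : ∀ {n} (i : Fin n) t → ∥ axis i t ∥ ≡ ∣ t ∣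
∥axis∥ {suc n} zero    t = trans (cong (∣ t ∣ ⊔_) (∥0ᵛ∥ n)) (ℕ.⊔-identityʳ _)
∥axis∥         (suc i) t = ∥axis∥ i t

∥neg∥ : ∀ {n} (g : ℤ^ n) → ∥ -ᵛ g ∥ ≡ ∥ g ∥
∥neg∥ []      = refl
∥neg∥ (a ∷ g) = cong₂ _⊔_ (ℤ.∣-i∣≡∣i∣ a) (∥neg∥ g)

∣lookup∣≤∥∥ : ∀ {n} (g : ℤ^ n) i → ∣ lookup g i ∣ ≤ ∥ g ∥
∣lookup∣≤∥∥ (a ∷ g) zero    = ℕ.m≤m⊔n _ _
∣lookup∣≤∥∥ (a ∷ g) (suc i) = ℕ.≤-trans (∣lookup∣≤∥∥ g i) (ℕ.m≤n⊔m ∣ a ∣ _)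

interval : ℕ → List ℤ
interval r = List.map +_ (upTo (suc r)) ++ List.map -[1+_] (upTo r)

∈-interval : ∀ {r} z → ∣ z ∣ ≤ r → z ∈ interval r
∈-interval     (+ m)    m≤r = ∈-++⁺ˡ (∈-map⁺ +_ (∈-upTo⁺ (s≤s m≤r)))
∈-interval {r} -[1+ m ] m<r = ∈-++⁺ʳ (List.map +_ (upTo (suc r))) (∈-map⁺ -[1+_] (∈-upTo⁺ m<r))

ball : ∀ n → ℕ → List (ℤ^ n)
ball zero    r = [] ∷ []
ball (suc n) r = List.cartesianProductWith _∷_ (interval r) (ball n r)

∈-ball : ∀ {n r} (g : ℤ^ n) → ∥ g ∥ ≤ r → g ∈ ball n r
∈-ball []      _   = here refl
∈-ball (a ∷ g) g≤r = ∈-cartesianProductWith⁺ _∷_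
  (∈-interval a (ℕ.m⊔n≤o⇒m≤o ∣ a ∣ _ g≤r)) (∈-ball g (ℕ.m⊔n≤o⇒n≤o ∣ a ∣ _ g≤r))

list-bound : ∀ {A : Set} (f : A → ℕ) L → Σ[ M ∈ ℕ ] All (λ a → f a ≤ M) L
list-bound f []      = 0 , []
list-bound f (a ∷ L) with M , f≤M ← list-bound f L =
  f a ⊔ M , ℕ.m≤m⊔n _ _ ∷ All.map (λ p → ℕ.≤-trans p (ℕ.m≤n⊔m (f a) M)) f≤M

ball-bound : ∀ n r (f : ℤ^ n → ℕ) → Σ[ M ∈ ℕ ] (∀ g → ∥ g ∥ ≤ r → f g ≤ M)
ball-bound n r f with M , f≤M ← list-bound f (ball n r) =
  M , λ g g≤r → All.lookup f≤M (∈-ball g g≤r)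

Fin-bound : ∀ {n} (f : Fin n → ℕ) → Σ[ M ∈ ℕ ] (∀ i → f i ≤ M)
Fin-bound {zero}  f = 0 , λ ()
Fin-bound {suc n} f with M , f≤M ← Fin-bound (f ∘ suc) = f zero ⊔ M , λ where
  zero    → ℕ.m≤m⊔n _ _
  (suc i) → ℕ.≤-trans (f≤M i) (ℕ.m≤n⊔m (f zero) M)

-- Locally constant functions on the free part

module _ {n : ℕ} where

  Agree : ℕ → 2^ℤ^ n → 2^ℤ^ n → Set
  Agree r x y = ∀ h → ∥ h ∥ ≤ r → x h ≡ y h

  Agree-sym : ∀ {r x y} → Agree r x y → Agree r y x
  Agree-sym p h h≤r = sym (p h h≤r)

  Agree-mono : ∀ {r s x y} → r ≤ s → Agree s x y → Agree r x y
  Agree-mono r≤s p h h≤r = p h (ℕ.≤-trans h≤r r≤s)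

  Agree-shift : ∀ {r x y} g → Agree (r + ∥ g ∥) x y → Agree r (g · x) (g · y)
  Agree-shift g p h h≤r = p (h +ᵛ g) (ℕ.≤-trans (∥∥-triangle h g) (ℕ.+-monoˡ-≤ ∥ g ∥ h≤r))

  LocallyConstant : {X : Set} → (F n → X) → Set
  LocallyConstant f = ∀ x → Σ[ r ∈ ℕ ] (∀ y → Agree r (proj₁ x) (proj₁ y) → f y ≡ f x)

  module _ {X : Set} {f : F n → X} (lc : LocallyConstant f) where

    LC-cong : ∀ {x y} → x ≗ᶠ y → f x ≡ f y
    LC-cong {x} {y} x≗y = sym (proj₂ (lc x) y (λ h _ → x≗y h))

    LC-shift : ∀ g → LocallyConstant (λ x → f (g ·ᶠ x))
    LC-shift g x with r , p ← lc (g ·ᶠ x) =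
      r + ∥ g ∥ , λ y agree → p (g ·ᶠ y) (Agree-shift g agree)

    LC-at : ∀ {g h} x → g ≡ h → f (g ·ᶠ x) ≡ f (h ·ᶠ x)
    LC-at x refl = refl

    LC-shift² : ∀ g h x → f (g ·ᶠ (h ·ᶠ x)) ≡ f ((g +ᵛ h) ·ᶠ x)
    LC-shift² g h x = LC-cong (λ k → cong (proj₁ x) (+ᵛ-assoc k g h))

    LC-0 : ∀ x → f (0ᵛ ·ᶠ x) ≡ f x
    LC-0 x = LC-cong (λ k → cong (proj₁ x) (+ᵛ-identityʳ k))

    -- The open set is a union of cylinders around free points. It has to be open in the whole
    -- shift, although `f` is defined only on the free part.
    LC⇒continuous : IsContinuous f
    LC⇒continuous P = U , U-open , λ x → mk⇔ (V⇒U x) (U⇒V x)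
      where
      U : 2^ℤ^ n → Set
      U z = Σ[ x ∈ F n ] P (f x) × Agree (proj₁ (lc x)) (proj₁ x) z

      U-open : IsOpen U
      U-open z (x , Pfx , x~z) = ball n (proj₁ (lc x)) , λ y y~z →
        x , Pfx , λ h h≤r → trans (x~z h h≤r) (sym (All.lookup y~z (∈-ball h h≤r)))

      V⇒U : ∀ x → P (f x) → U (proj₁ x)
      V⇒U x Pfx = x , Pfx , λ _ _ → refl

      U⇒V : ∀ y → U (proj₁ y) → P (f y)
      U⇒V y (x , Pfx , x~y) = subst P (sym (proj₂ (lc x) y x~y)) Pfx

  continuous⇒LC : ∀ {X : Set} {f : F n → X} → IsContinuous f → LocallyConstant f
  continuous⇒LC {f = f} cont x
    with U , U-open , V⇔U ← cont (_≡ f x)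
    with W , W⇒U ← U-open (proj₁ x) (Equivalence.to (V⇔U x) refl)
    with r , W≤r ← list-bound ∥_∥ W =
    r , λ y x~y → Equivalence.from (V⇔U y)
      (W⇒U (proj₁ y) (All.map (λ {h} h≤r → sym (x~y h h≤r)) W≤r))

  LC-const : ∀ {X : Set} (a : X) → LocallyConstant (λ _ → a)
  LC-const a x = 0 , λ _ _ → refl

  LC-bind : ∀ {X Y : Set} {f : F n → X} {g : X → F n → Y} → LocallyConstant f →
            (∀ a → LocallyConstant (g a)) → LocallyConstant (λ x → g (f x) x)
  LC-bind {f = f} {g} lf lg x
    with r , p ← lf x | s , q ← lg (f x) x =
    r ⊔ s , λ y x~y → trans
      (cong (λ a → g a y) (p y (Agree-mono (ℕ.m≤m⊔n r s) x~y)))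
      (q y (Agree-mono (ℕ.m≤n⊔m r s) x~y))

  LC-map : ∀ {X Y : Set} {f : F n → X} (h : X → Y) → LocallyConstant f → LocallyConstant (h ∘ f)
  LC-map h lf x with r , p ← lf x = r , λ y x~y → cong h (p y x~y)

-- Maximal independent sets of translation-invariant conflicts

LC-pair : ∀ {n} {X Y : Set} {f : F n → X} {g : F n → Y} →
          LocallyConstant f → LocallyConstant g → LocallyConstant (λ x → f x , g x)
LC-pair lf lg = LC-bind lf (λ a → LC-map (a ,_) lg)

LC-family : ∀ {n} {X : Set} {f : ℤ^ n → Fin n → F n → X} →
            (∀ g j → LocallyConstant (f g j)) → ∀ R x →
            Σ[ r ∈ ℕ ] (∀ y → Agree r (proj₁ x) (proj₁ y) → ∀ g j → ∥ g ∥ ≤ R → f g j y ≡ f g j x)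
LC-family {n} lf R x
  with r , r-max ← ball-bound n R (λ g → proj₁ (Fin-bound (λ j → proj₁ (lf g j x)))) =
  r , λ y x~y g j g≤R → proj₂ (lf g j x) y
    (Agree-mono (ℕ.≤-trans (proj₂ (Fin-bound (λ j → proj₁ (lf g j x))) j) (r-max g g≤R)) x~y)

-- `ℕᵇ` is bijective base 2, with digits 1 and 2 and no leading zeros, so distinct bit strings are
-- distinct numbers whatever their lengths.
bits : List Bool → ℕᵇ
bits []          = zero
bits (true ∷ l)  = 2[1+ bits l ]
bits (false ∷ l) = 1+[2 bits l ]

bits-injective : ∀ k l → bits k ≡ bits l → k ≡ l
bits-injective []          []          _  = refl
bits-injective []          (true ∷ l)  ()
bits-injective []          (false ∷ l) ()
bits-injective (true ∷ k)  []          ()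
bits-injective (true ∷ k)  (true ∷ l)  eq = cong (true ∷_) (bits-injective k l (ℕᵇ.2[1+_]-injective eq))
bits-injective (true ∷ k)  (false ∷ l) ()
bits-injective (false ∷ k) []          ()
bits-injective (false ∷ k) (true ∷ l)  ()
bits-injective (false ∷ k) (false ∷ l) eq = cong (false ∷_) (bits-injective k l (ℕᵇ.1+[2_]-injective eq))

-- A prefix code: `a` digits 2, closed by a digit 1, then the digits of `b`.
pair : ℕ → ℕᵇ → ℕᵇ
pair zero    b = 1+[2 b ]
pair (suc a) b = 2[1+ pair a b ]

pair-injective : ∀ {a a′ b b′} → pair a b ≡ pair a′ b′ → a ≡ a′ × b ≡ b′
pair-injective {zero}  {zero}   refl = refl , refl
pair-injective {suc a} {suc a′} eq
  with refl , refl ← pair-injective {a} {a′} (ℕᵇ.2[1+_]-injective eq) = refl , refl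

map-≡⇒∈ : ∀ {A B : Set} {f g : A → B} {L} → List.map f L ≡ List.map g L → ∀ {a} → a ∈ L → f a ≡ g a
map-≡⇒∈ {L = a ∷ L} eq (here refl) = proj₁ (List.∷-injective eq)
map-≡⇒∈ {L = a ∷ L} eq (there a∈L) = map-≡⇒∈ (proj₂ (List.∷-injective eq)) a∈L

IsLeast : (ℕ → Set) → ℕ → Set
IsLeast P m = P m × (∀ k → k < m → ¬ P k)

module Classical (em : ExcludedMiddle 0ℓ) where

  byContradiction : {P : Set} → ¬ ¬ P → P
  byContradiction = decidable-stable em

  ⌊_⌋ : Set → Bool
  ⌊ P ⌋ = does (em {P})

  least : (P : ℕ → Set) → Σ[ m ∈ ℕ ] P m → Σ[ m ∈ ℕ ] IsLeast P m
  least P (m , Pm) = go 0 m (λ _ ()) (subst P (sym (ℕ.+-identityʳ m)) Pm)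
    where
    go : ∀ k d → (∀ j → j < k → ¬ P j) → P (d + k) → Σ[ m ∈ ℕ ] IsLeast P m
    go k zero    below Pk = k , Pk , below
    go k (suc d) below Pd with em {P k}
    ... | yes Pk = k , Pk , below
    ... | no ¬Pk = go (suc k) d below′ (subst P (sym (ℕ.+-suc d k)) Pd)
      where
      below′ : ∀ j → j < suc k → ¬ P j
      below′ j j<1+k Pj with ℕ.m<1+n⇒m<n∨m≡n j<1+k
      ... | inj₁ j<k  = below j j<k Pj
      ... | inj₂ refl = ¬Pk Pj

  -- The priority of x encodes the pattern of x on the least ball on which x
  -- differs from all its translates by nonzero vectors of norm at most R.
  module Priority (n R : ℕ) where

    Separates : 2^ℤ^ n → ℕ → Set
    Separates x m = ∀ g → g ≢ 0ᵛ → ∥ g ∥ ≤ R → Σ[ h ∈ ℤ^ n ] ∥ h ∥ ≤ m × x h ≢ x (h +ᵛ g)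

    separating : ∀ (x : F n) → Σ[ m ∈ ℕ ] Separates (proj₁ x) m
    separating (x , free) = m , λ g g≢0 g≤R → sep g g≢0 (bound g g≤R)
      where
      differ : ∀ g → g ≢ 0ᵛ → Σ[ h ∈ ℤ^ n ] x h ≢ x (h +ᵛ g)
      differ g g≢0 = byContradiction λ none →
        free g g≢0 λ h → sym (byContradiction λ x≢ → none (h , x≢))

      size : ∀ g → Dec (g ≢ 0ᵛ) → ℕ
      size g (yes g≢0) = ∥ proj₁ (differ g g≢0) ∥
      size g (no _)    = 0

      ball-sizes : Σ[ m ∈ ℕ ] (∀ g → ∥ g ∥ ≤ R → size g em ≤ m)
      ball-sizes = ball-bound n R (λ g → size g em)

      m : ℕ
      m = proj₁ ball-sizes

      bound : ∀ g → ∥ g ∥ ≤ R → size g em ≤ m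
      bound = proj₂ ball-sizes

      sep : ∀ g → g ≢ 0ᵛ → size g em ≤ m → Σ[ h ∈ ℤ^ n ] ∥ h ∥ ≤ m × x h ≢ x (h +ᵛ g)
      sep g g≢0 size≤m with em {g ≢ 0ᵛ}
      ... | yes g≢0′ = proj₁ (differ g g≢0′) , size≤m , proj₂ (differ g g≢0′)
      ... | no ¬g≢0  = contradiction g≢0 ¬g≢0

    Separates-transfer : ∀ {x y m} → Agree (m + R) x y → Separates x m → Separates y m
    Separates-transfer {x} {y} {m} x~y sep g g≢0 g≤R with h , h≤m , x≢ ← sep g g≢0 g≤R =
      h , h≤m , λ y≡ → x≢ (begin
        x h         ≡⟨ x~y h (ℕ.≤-trans h≤m (ℕ.m≤m+n m R)) ⟩
        y h         ≡⟨ y≡ ⟩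
        y (h +ᵛ g)  ≡⟨ x~y (h +ᵛ g) (ℕ.≤-trans (∥∥-triangle h g) (ℕ.+-mono-≤ h≤m g≤R)) ⟨
        x (h +ᵛ g)  ∎)
      where open ≡-Reasoning

    least-scale : ∀ (x : F n) → Σ[ m ∈ ℕ ] IsLeast (Separates (proj₁ x)) m
    least-scale x = least (Separates (proj₁ x)) (separating x)

    scale : F n → ℕ
    scale x = proj₁ (least-scale x)

    -- Testing separation on radius `m` reads `x` up to radius `m + R`. Two points that agree up to
    -- `scale x + R` therefore pass the same tests up to `scale x`, and neither can have the smaller
    -- scale.
    scale-LC : LocallyConstant scale
    scale-LC x = scale x + R , eq
      where
      eq : ∀ y → Agree (scale x + R) (proj₁ x) (proj₁ y) → scale y ≡ scale x
      eq y x~y with ℕ.<-cmp (scale y) (scale x)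
      ... | tri< lt _ _ = contradiction
        (Separates-transfer (Agree-mono (ℕ.+-monoˡ-≤ R (ℕ.<⇒≤ lt)) (Agree-sym x~y))
                            (proj₁ (proj₂ (least-scale y))))
        (proj₂ (proj₂ (least-scale x)) _ lt)
      ... | tri≈ _ e _  = e
      ... | tri> _ _ gt = contradiction
        (Separates-transfer x~y (proj₁ (proj₂ (least-scale x))))
        (proj₂ (proj₂ (least-scale y)) _ gt)

    pattern-at : ℕ → F n → List Bool
    pattern-at m x = List.map (proj₁ x) (ball n m)

    pattern-LC : ∀ m → LocallyConstant (pattern-at m)
    pattern-LC m x with r , ball≤r ← list-bound ∥_∥ (ball n m) =
      r , λ y x~y → List.map-cong-local (All.map (λ h≤r → sym (x~y _ h≤r)) ball≤r)

    priority : F n → Fin n → ℕ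
    priority x i = ℕᵇ.toℕ (pair (toℕ i) (pair (scale x) (bits (pattern-at (scale x) x))))

    priority-LC : ∀ i → LocallyConstant (λ x → priority x i)
    priority-LC i = LC-bind scale-LC
      (λ m → LC-map (λ l → ℕᵇ.toℕ (pair (toℕ i) (pair m (bits l)))) (pattern-LC m))

    -- Equal codes mean equal directions, equal scales and equal patterns on the ball of that
    -- radius. On this very ball `x` differs from each of its short nonzero translates.
    priority-separates : ∀ x g {i j} → ∥ g ∥ ≤ R → priority x i ≡ priority (g ·ᶠ x) j →
                         i ≡ j × g ≡ 0ᵛ
    priority-separates x g {i} {j} g≤R eq
      with i≡j , eq′ ← pair-injective (ℕᵇ.toℕ-injective eq)
      with m≡m′ , eq″ ← pair-injective {scale x} eq′ =
      Fin.toℕ-injective i≡j , byContradiction λ g≢0 →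
        let h , h≤m , x≢ = proj₁ (proj₂ (least-scale x)) g g≢0 g≤R
            same = trans (bits-injective (pattern-at (scale x) x) _ eq″)
                         (cong (λ m → pattern-at m (g ·ᶠ x)) (sym m≡m′))
        in x≢ (map-≡⇒∈ same (∈-ball h h≤m))

  -- Greedy choice in order of priority

  module MaximalIndependent
    (n R : ℕ)
    (priority : F n → Fin n → ℕ) (priority-LC : ∀ i → LocallyConstant (λ x → priority x i))
    (priority-separates : ∀ x g {i j} → ∥ g ∥ ≤ R → priority x i ≡ priority (g ·ᶠ x) j → i ≡ j × g ≡ 0ᵛ)
    (Conflict : Fin n → Fin n → ℤ^ n → Set)
    (conflict-bounded : ∀ {i j g} → Conflict i j g → ∥ g ∥ ≤ R)
    (conflict-sym : ∀ {i j g} → Conflict i j g → Conflict j i (-ᵛ g))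
    (conflict-irrefl : ∀ {i} → ¬ Conflict i i 0ᵛ) where

    mutual
      -- `stage m` is the greedy decision for pairs of priority below `m`; elsewhere its value is a
      -- placeholder. Only strictly smaller priorities are consulted, so the decision no longer
      -- changes once `m` exceeds the priority.
      Blocked : ℕ → F n → Fin n → Set
      Blocked m x i = Σ[ g ∈ ℤ^ n ] Σ[ j ∈ Fin n ]
        Conflict i j g × priority (g ·ᶠ x) j < priority x i × stage m (g ·ᶠ x) j ≡ true

      stage : ℕ → F n → Fin n → Bool
      stage zero    x i = false
      stage (suc m) x i = not ⌊ Blocked m x i ⌋

    stage-LC : ∀ m i → LocallyConstant (λ x → stage m x i)
    stage-LC zero    i = LC-const false
    stage-LC (suc m) i x
      with r , p ← LC-family (λ g j → LC-shift (LC-pair (priority-LC j) (stage-LC m j)) g) R x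
         | s , q ← priority-LC i x =
      r ⊔ s , λ y x~y →
        let y≡x = p y (Agree-mono (ℕ.m≤m⊔n r s) x~y)
            q≡  = q y (Agree-mono (ℕ.m≤n⊔m r s) x~y)
        in cong not (does-⇔ (mk⇔
          (λ (g , j , c , lt , st) → g , j , c ,
            subst₂ _<_ (cong proj₁ (y≡x g j (conflict-bounded c))) q≡ lt ,
            trans (sym (cong proj₂ (y≡x g j (conflict-bounded c)))) st)
          (λ (g , j , c , lt , st) → g , j , c ,
            subst₂ _<_ (sym (cong proj₁ (y≡x g j (conflict-bounded c)))) (sym q≡) lt ,
            trans (cong proj₂ (y≡x g j (conflict-bounded c))) st))
          em em)

    stage-stable : ∀ {m m′ x i} → priority x i < m → priority x i < m′ → stage m x i ≡ stage m′ x i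
    stage-stable {suc m} {suc m′} {x} {i} (s≤s p≤m) (s≤s p≤m′) = cong not (does-⇔ (mk⇔
      (λ (g , j , c , lt , st) → g , j , c , lt ,
        trans (sym (stage-stable (ℕ.<-≤-trans lt p≤m) (ℕ.<-≤-trans lt p≤m′))) st)
      (λ (g , j , c , lt , st) → g , j , c , lt ,
        trans (stage-stable (ℕ.<-≤-trans lt p≤m) (ℕ.<-≤-trans lt p≤m′)) st))
      em em)

    chosen : F n → Fin n → Bool
    chosen x i = stage (suc (priority x i)) x i

    chosen-LC : ∀ i → LocallyConstant (λ x → chosen x i)
    chosen-LC i = LC-bind (priority-LC i) (λ p → stage-LC (suc p) i)

    private
      no-smaller : ∀ {x i g j} → Conflict i j g → priority (g ·ᶠ x) j < priority x i →
                   chosen x i ≡ true → chosen (g ·ᶠ x) j ≢ true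
      no-smaller {x} {i} {g} {j} c lt Axi Agxj
        with em {Blocked (priority x i) x i} | Axi
      ... | no ¬blocked | _ = ¬blocked (g , j , c , lt , trans (stage-stable lt (ℕ.n<1+n _)) Agxj)

    -- Conflicting pairs never tie in priority, so one of them is decided first; if it is chosen, it
    -- blocks the other.
    chosen-independent : ∀ {x i g j} → Conflict i j g → chosen x i ≡ true →
                         chosen (g ·ᶠ x) j ≢ true
    chosen-independent {x} {i} {g} {j} c Axi Agxj
      with ℕ.<-cmp (priority (g ·ᶠ x) j) (priority x i)
    ... | tri< lt _ _ = no-smaller c lt Axi Agxj
    ... | tri≈ _ eq _ with refl , refl ← priority-separates x g (conflict-bounded c) (sym eq) =
      conflict-irrefl c
    ... | tri> _ _ gt = no-smaller (conflict-sym c) 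
        (subst (_< priority (g ·ᶠ x) j) (sym (back (priority-LC i))) gt)
        Agxj (trans (back (chosen-LC i)) Axi)
      where
      back : ∀ {X : Set} {f : F n → X} → LocallyConstant f → f ((-ᵛ g) ·ᶠ (g ·ᶠ x)) ≡ f x
      back lf = trans (LC-shift² lf (-ᵛ g) g x)
        (trans (LC-at lf x (+ᵛ-inverseˡ g)) (LC-0 lf x))

    chosen-maximal : ∀ x i → chosen x i ≡ false →
                     Σ[ g ∈ ℤ^ n ] Σ[ j ∈ Fin n ] Conflict i j g × chosen (g ·ᶠ x) j ≡ true
    chosen-maximal x i Axi with yes (g , j , c , lt , st) ← em {Blocked (priority x i) x i} =
      g , j , c , trans (stage-stable (ℕ.n<1+n _) lt) st

-- Marked edges

i-j+j : ∀ i j → (i ℤ.- j) ℤ.+ j ≡ i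
i-j+j = solve-∀

∣+m-+n∣≤ : ∀ {a d m n} → a ≤ m → m ≤ a + d → a ≤ n → n ≤ a + d → ∣ + m ℤ.- + n ∣ ≤ d
∣+m-+n∣≤ {a} {d} {m} {n} a≤m m≤ a≤n n≤ = begin
  ∣ + m ℤ.- + n ∣  ≡⟨ cong ∣_∣ (ℤ.m-n≡m⊖n m n) ⟩
  ∣ m ℤ.⊖ n ∣      ≤⟨ bound ⟩
  d                ∎
  where
  open ℕ.≤-Reasoning
  bound : ∣ m ℤ.⊖ n ∣ ≤ d
  bound with ℕ.≤-total n m
  ... | inj₁ n≤m rewrite ℤ.⊖-≥ n≤m =
    ℕ.≤-trans (ℕ.∸-mono m≤ a≤n) (ℕ.≤-reflexive (ℕ.m+n∸m≡n a d))
  ... | inj₂ m≤n rewrite ℤ.∣⊖∣-≤ m≤n =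
    ℕ.≤-trans (ℕ.∸-mono n≤ a≤m) (ℕ.≤-reflexive (ℕ.m+n∸m≡n a d))

far-apart : ∀ {s t m n} → ∣ s ∣ ≤ 1 → ∣ t ∣ ≤ 1 → m + 3 ≤ n → t ℤ.+ + n ≢ s ℤ.+ + m
far-apart {s} {t} {m} {n} s≤1 t≤1 m+3≤n eq = ℕ.<⇒≱ 3≤δ δ≤2
  where
  δ : ℕ
  δ = n ∸ m

  n≡ : n ≡ δ + m
  n≡ = sym (ℕ.m∸n+n≡m (ℕ.≤-trans (ℕ.m≤m+n m 3) m+3≤n))

  3≤δ : 3 ≤ δ
  3≤δ = ℕ.≤-trans (ℕ.≤-reflexive (sym (ℕ.m+n∸m≡n m 3))) (ℕ.∸-monoˡ-≤ m m+3≤n)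

  move : ∀ s t d m → t ℤ.+ (d ℤ.+ m) ≡ s ℤ.+ m → d ≡ s ℤ.- t
  move s t d m eq = begin
    d                                       ≡⟨ lhs t d m ⟩
    (t ℤ.+ (d ℤ.+ m)) ℤ.- (t ℤ.+ m)         ≡⟨ cong (ℤ._- (t ℤ.+ m)) eq ⟩
    (s ℤ.+ m) ℤ.- (t ℤ.+ m)                 ≡⟨ rhs s t m ⟩
    s ℤ.- t                                 ∎
    where
    open ≡-Reasoning
    lhs : ∀ t d m → d ≡ (t ℤ.+ (d ℤ.+ m)) ℤ.- (t ℤ.+ m)
    lhs = solve-∀
    rhs : ∀ s t m → (s ℤ.+ m) ℤ.- (t ℤ.+ m) ≡ s ℤ.- t
    rhs = solve-∀

  δ≡ : + δ ≡ s ℤ.- t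
  δ≡ = move s t (+ δ) (+ m) (trans (cong (λ k → t ℤ.+ + k) (sym n≡)) eq)

  δ≤2 : δ ≤ 2
  δ≤2 = ℕ.≤-trans (ℕ.≤-reflexive (cong ∣_∣ δ≡))
          (ℕ.≤-trans (ℤ.∣i-j∣≤∣i∣+∣j∣ s t) (ℕ.+-mono-≤ s≤1 t≤1))

signFin : Sign → Fin 2
signFin Sign.- = zero
signFin Sign.+ = suc zero

signFin-injective : ∀ s t → signFin s ≡ signFin t → s ≡ t
signFin-injective Sign.- Sign.- _ = refl
signFin-injective Sign.+ Sign.+ _ = refl

ℤ→Fin : ∀ {r} s → ∣ s ∣ ≤ r → Fin (2 * suc r)
ℤ→Fin s s≤r = combine (signFin (ℤ.sign s)) (fromℕ< (s≤s s≤r))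

ℤ→Fin-injective : ∀ {r} s t (s≤r : ∣ s ∣ ≤ r) (t≤r : ∣ t ∣ ≤ r) → ℤ→Fin s s≤r ≡ ℤ→Fin t t≤r → s ≡ t
ℤ→Fin-injective s t s≤r t≤r eq
  with sgn , abs ← Fin.combine-injective (signFin (ℤ.sign s)) _ (signFin (ℤ.sign t)) _ eq = begin
  s                    ≡⟨ ℤ.◃-inverse s ⟨
  ℤ.sign s ℤ.◃ ∣ s ∣      ≡⟨ cong₂ ℤ._◃_ (signFin-injective _ _ sgn) (Fin.fromℕ<-injective _ _ (s≤s s≤r) (s≤s t≤r) abs) ⟩
  ℤ.sign t ℤ.◃ ∣ t ∣      ≡⟨ ℤ.◃-inverse t ⟩
  t                    ∎
  where open ≡-Reasoning

module _ {n : ℕ} where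

  lookup-0ᵛ : ∀ (i : Fin n) → lookup 0ᵛ i ≡ 0ℤ
  lookup-0ᵛ i = lookup-replicate i 0ℤ

  lookup-+ᵛ : ∀ i (g h : ℤ^ n) → lookup (g +ᵛ h) i ≡ lookup g i ℤ.+ lookup h i
  lookup-+ᵛ = lookup-zipWith ℤ._+_

  plane-+ : ∀ (i j : Fin n) s t s′ t′ →
            (axis i s +ᵛ axis j t) +ᵛ (axis i s′ +ᵛ axis j t′) ≡ axis i (s ℤ.+ s′) +ᵛ axis j (t ℤ.+ t′)
  plane-+ i j s t s′ t′ = trans (+ᵛ-interchange (axis i s) (axis j t) (axis i s′) (axis j t′))
    (cong₂ _+ᵛ_ (axis-+ i s s′) (axis-+ j t t′))

-- The pair (x , i) stands for the edge joining x and e i · x.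
module ConflictDefs (n : ℕ) where

  -- A block of `n + 1` disjoint candidate edges spans `r` steps. Blocks start `w` apart, which
  -- keeps candidates of different blocks at least 3 apart. `labels` counts a direction together
  -- with a signed offset of size at most `r`. `K` exceeds each of the `labels + 1` blocks'
  -- candidate positions by at least 2, and `D` adds the reach of `line` to `K`.
  r w labels K D : ℕ
  r      = suc (2 * n)
  w      = 2 * n + 3
  labels = n * (2 * suc r)
  K      = labels * w + 2 * n + 2
  D      = K + K

  -- Conflict i j g: the edges (x , i) and (g · x , j) must not both be marked.
  data Conflict (i j : Fin n) (g : ℤ^ n) : Set where
    line  : i ≡ j → ∀ t → t ≢ 0ℤ → ∣ t ∣ ≤ K → g ≡ axis i t → Conflict i j g
    para  : i ≡ j → ∀ k s t → k ≢ i → s ≢ 0ℤ → ∣ s ∣ ≤ r → ∣ t ∣ ≤ 1 →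
            g ≡ axis k s +ᵛ axis i t → Conflict i j g
    touch : i ≢ j → ∀ a b → a ≤ 1 → b ≤ 1 → g ≡ axis i (+ a) +ᵛ axis j (ℤ.- + b) → Conflict i j g

  private
    neg≢0 : ∀ {t} → t ≢ 0ℤ → ℤ.- t ≢ 0ℤ
    neg≢0 {t} t≢0 eq = t≢0 (trans (sym (ℤ.neg-involutive t)) (cong ℤ.-_ eq))

    neg≤ : ∀ t {m} → ∣ t ∣ ≤ m → ∣ ℤ.- t ∣ ≤ m
    neg≤ t t≤m = ℕ.≤-trans (ℕ.≤-reflexive (ℤ.∣-i∣≡∣i∣ t)) t≤m

    neg-plane : ∀ (i j : Fin n) s t → -ᵛ (axis i s +ᵛ axis j t) ≡ axis i (ℤ.- s) +ᵛ axis j (ℤ.- t)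
    neg-plane i j s t = trans (neg-+ᵛ (axis i s) (axis j t)) (cong₂ _+ᵛ_ (axis-neg i s) (axis-neg j t))

    ∥plane∥≤ : ∀ (i j : Fin n) {s t a b} → ∣ s ∣ ≤ a → ∣ t ∣ ≤ b → ∥ axis i s +ᵛ axis j t ∥ ≤ a + b
    ∥plane∥≤ i j {s} {t} s≤a t≤b = ℕ.≤-trans (∥∥-triangle (axis i s) (axis j t))
      (ℕ.+-mono-≤ (ℕ.≤-trans (ℕ.≤-reflexive (∥axis∥ i s)) s≤a) (ℕ.≤-trans (ℕ.≤-reflexive (∥axis∥ j t)) t≤b))

  conflict-sym : ∀ {i j g} → Conflict i j g → Conflict j i (-ᵛ g)
  conflict-sym (line refl t t≢0 t≤K refl) = line refl (ℤ.- t) (neg≢0 t≢0) (neg≤ t t≤K) (axis-neg _ t)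
  conflict-sym (para refl k s t k≢i s≢0 s≤r t≤1 refl) =
    para refl k (ℤ.- s) (ℤ.- t) k≢i (neg≢0 s≢0) (neg≤ s s≤r) (neg≤ t t≤1) (neg-plane k _ s t)
  conflict-sym {i} {j} (touch i≢j a b a≤1 b≤1 refl) = touch (i≢j ∘ sym) b a b≤1 a≤1 (begin
    -ᵛ (axis i (+ a) +ᵛ axis j (ℤ.- + b))          ≡⟨ neg-plane i j (+ a) (ℤ.- + b) ⟩
    axis i (ℤ.- + a) +ᵛ axis j (ℤ.- ℤ.- + b)       ≡⟨ +ᵛ-comm (axis i (ℤ.- + a)) _ ⟩
    axis j (ℤ.- ℤ.- + b) +ᵛ axis i (ℤ.- + a)       ≡⟨ cong (λ t → axis j t +ᵛ _) (ℤ.neg-involutive (+ b)) ⟩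
    axis j (+ b) +ᵛ axis i (ℤ.- + a)               ∎)
    where open ≡-Reasoning

  conflict-irrefl : ∀ {i} → ¬ Conflict i i 0ᵛ
  conflict-irrefl {i} (line _ t t≢0 _ eq) = t≢0 (trans (sym (lookup-axis i t))
    (trans (cong (λ v → lookup v i) (sym eq)) (lookup-0ᵛ i)))
  conflict-irrefl {i} (para _ k s t k≢i s≢0 _ _ eq) = s≢0 (begin
    s                                           ≡⟨ ℤ.+-identityʳ s ⟨
    s ℤ.+ 0ℤ                                    ≡⟨ cong₂ ℤ._+_ (lookup-axis k s) (lookup-axis′ k≢i t) ⟨
    lookup (axis k s) k ℤ.+ lookup (axis i t) k ≡⟨ lookup-+ᵛ k (axis k s) (axis i t) ⟨
    lookup (axis k s +ᵛ axis i t) k             ≡⟨ cong (λ v → lookup v k) eq ⟨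
    lookup 0ᵛ k                                 ≡⟨ lookup-0ᵛ k ⟩
    0ℤ                                          ∎)
    where open ≡-Reasoning
  conflict-irrefl (touch i≢i _ _ _ _ _) = i≢i refl

  conflict-bounded : ∀ {i j g} → Conflict i j g → ∥ g ∥ ≤ K + suc r
  conflict-bounded {i} (line _ t _ t≤K refl) =
    ℕ.≤-trans (ℕ.≤-reflexive (∥axis∥ i t)) (ℕ.≤-trans t≤K (ℕ.m≤m+n K _))
  conflict-bounded {i} (para _ k s t _ _ s≤r t≤1 refl) = ℕ.≤-trans (∥plane∥≤ k i s≤r t≤1)
    (ℕ.≤-trans (ℕ.≤-reflexive (ℕ.+-comm r 1)) (ℕ.m≤n+m (suc r) K))
  conflict-bounded {i} {j} (touch _ a b a≤1 b≤1 refl) = ℕ.≤-trans (∥plane∥≤ i j a≤1 (neg≤ (+ b) b≤1))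
    (ℕ.≤-trans (s≤s (s≤s z≤n)) (ℕ.m≤n+m (suc r) K))

  -- Bounded gaps between marked edges on a line

  module Density (em : ExcludedMiddle 0ℓ) (B : ℤ^ n → Fin n → Bool)
    (independent : ∀ {u i g j} → Conflict i j g → B u i ≡ true → B (g +ᵛ u) j ≢ true)
    (maximal : ∀ u i → B u i ≡ false → Σ[ g ∈ ℤ^ n ] Σ[ j ∈ Fin n ] Conflict i j g × B (g +ᵛ u) j ≡ true)
    where

    open Classical em

    module _ (i : Fin n) (unmarked : ∀ t → ∣ t ∣ ≤ D → B (axis i t) i ≢ true) where

      candidate : Fin (suc labels) → Fin (suc n) → ℕ
      candidate β π = toℕ β * w + 2 * toℕ π

      2π≤2n : ∀ (π : Fin (suc n)) → 2 * toℕ π ≤ 2 * n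
      2π≤2n π = ℕ.*-monoʳ-≤ 2 (ℕ.≤-pred (Fin.toℕ<n π))

      candidate≤ : ∀ β π → candidate β π ≤ labels * w + 2 * n
      candidate≤ β π = ℕ.+-mono-≤ (ℕ.*-monoˡ-≤ w (ℕ.≤-pred (Fin.toℕ<n β))) (2π≤2n π)

      candidate-apart : ∀ {β β′} π π′ → toℕ β < toℕ β′ → candidate β π + 3 ≤ candidate β′ π′
      candidate-apart {β} {β′} π π′ β<β′ = begin
        toℕ β * w + 2 * toℕ π + 3      ≡⟨ ℕ.+-assoc (toℕ β * w) _ 3 ⟩
        toℕ β * w + (2 * toℕ π + 3)    ≤⟨ ℕ.+-monoʳ-≤ (toℕ β * w) (ℕ.+-monoˡ-≤ 3 (2π≤2n π)) ⟩
        toℕ β * w + w                  ≡⟨ ℕ.+-comm (toℕ β * w) w ⟩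
        suc (toℕ β) * w                ≤⟨ ℕ.*-monoˡ-≤ w β<β′ ⟩
        toℕ β′ * w                     ≤⟨ ℕ.m≤m+n _ _ ⟩
        toℕ β′ * w + 2 * toℕ π′        ∎
        where open ℕ.≤-Reasoning

      Touched Shadowed : ℕ → Set
      Touched m  = Σ[ j ∈ Fin n ] i ≢ j × (Σ[ a ∈ ℕ ] Σ[ b ∈ ℕ ] a ≤ 1 × b ≤ 1 ×
                   B (axis i (+ (a + m)) +ᵛ axis j (ℤ.- + b)) j ≡ true)
      Shadowed m = Σ[ k ∈ Fin n ] Σ[ s ∈ ℤ ] ∣ s ∣ ≤ r × (Σ[ t ∈ ℤ ] ∣ t ∣ ≤ 1 ×
                   B (axis k s +ᵛ axis i (t ℤ.+ + m)) i ≡ true)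

      -- A `line` conflict is impossible here: it would give a marked edge on the same line at
      -- distance at most `K + K`, which is `D`.
      blocked : ∀ m → m ≤ K → Touched m ⊎ Shadowed m
      blocked m m≤K with maximal (axis i (+ m)) i (Bool.¬-not (unmarked (+ m) (ℕ.≤-trans m≤K (ℕ.m≤m+n K K))))
      ... | g , j , line refl t _ t≤K refl , Bg = contradiction
        (trans (cong (λ v → B v i) (sym (axis-+ i t (+ m)))) Bg)
        (unmarked (t ℤ.+ + m) (ℕ.≤-trans (ℤ.∣i+j∣≤∣i∣+∣j∣ t (+ m)) (ℕ.+-mono-≤ t≤K m≤K)))
      ... | g , j , para refl k s t k≢i s≢0 s≤r t≤1 refl , Bg = inj₂ (k , s , s≤r , t , t≤1 ,
        trans (cong (λ v → B v i) (sym (trans (+ᵛ-assoc (axis k s) (axis i t) _)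
          (cong (axis k s +ᵛ_) (axis-+ i t (+ m)))))) Bg)
      ... | g , j , touch i≢j a b a≤1 b≤1 refl , Bg = inj₁ (j , i≢j , a , b , a≤1 , b≤1 ,
        trans (cong (λ v → B v j) (sym eq)) Bg)
        where
        open ≡-Reasoning
        eq : (axis i (+ a) +ᵛ axis j (ℤ.- + b)) +ᵛ axis i (+ m) ≡ axis i (+ (a + m)) +ᵛ axis j (ℤ.- + b)
        eq = begin
          (axis i (+ a) +ᵛ axis j (ℤ.- + b)) +ᵛ axis i (+ m)  ≡⟨ +ᵛ-assoc (axis i (+ a)) _ _ ⟩
          axis i (+ a) +ᵛ (axis j (ℤ.- + b) +ᵛ axis i (+ m))  ≡⟨ cong (axis i (+ a) +ᵛ_) (+ᵛ-comm (axis j (ℤ.- + b)) _) ⟩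
          axis i (+ a) +ᵛ (axis i (+ m) +ᵛ axis j (ℤ.- + b))  ≡⟨ +ᵛ-assoc (axis i (+ a)) _ _ ⟨
          (axis i (+ a) +ᵛ axis i (+ m)) +ᵛ axis j (ℤ.- + b)  ≡⟨ cong (_+ᵛ axis j (ℤ.- + b)) (axis-+ i (+ a) (+ m)) ⟩
          axis i (+ (a + m)) +ᵛ axis j (ℤ.- + b)              ∎

      -- The n + 1 candidates in a block are disjoint edges, and the marked
      -- edges in one direction j ≠ i touch at most one of them.
      not-all-touched : ∀ β → ¬ (∀ π → Touched (candidate β π))
      not-all-touched β touched
        with π , π′ , π<π′ , j≡ ← Fin.pigeonhole (ℕ.n<1+n n) (proj₁ ∘ touched)
        with touched π | touched π′
      ... | j , i≢j , a , b , a≤1 , b≤1 , Bu | j′ , _ , a′ , b′ , a′≤1 , b′≤1 , Bu′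
        with refl ← j≡ =
        -- The two marked edges in direction `j` meet the line at distinct points `α` and `α′`, each
        -- by either of its endpoints. This is why `para` allows a displacement of at most 1 along
        -- the edges.
        independent (para refl i (α′ ℤ.- α) ((ℤ.- + b′) ℤ.- (ℤ.- + b)) i≢j α′≢α α-close b-close refl) Bu
          (trans (cong (λ v → B v j) (trans (plane-+ i j (α′ ℤ.- α) ((ℤ.- + b′) ℤ.- (ℤ.- + b)) α (ℤ.- + b))
            (cong₂ (λ s t → axis i s +ᵛ axis j t) (i-j+j α′ α) (i-j+j (ℤ.- + b′) (ℤ.- + b))))) Bu′)
        where
        m m′ o : ℕ
        m  = a + candidate β π
        m′ = a′ + candidate β π′
        o  = toℕ β * w

        α α′ : ℤ
        α  = + m
        α′ = + m′

        m<m′ : m < m′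
        m<m′ = begin-strict
          a + (o + 2 * toℕ π)        ≤⟨ ℕ.+-monoˡ-≤ _ a≤1 ⟩
          1 + (o + 2 * toℕ π)        <⟨ ℕ.n<1+n _ ⟩
          2 + (o + 2 * toℕ π)        ≡⟨ ℕ.+-comm 2 _ ⟩
          o + 2 * toℕ π + 2          ≡⟨ ℕ.+-assoc o _ 2 ⟩
          o + (2 * toℕ π + 2)        ≡⟨ cong (λ z → o + z) (ℕ.+-comm _ 2) ⟩
          o + (2 + 2 * toℕ π)        ≡⟨ cong (λ z → o + z) (ℕ.*-suc 2 (toℕ π)) ⟨
          o + 2 * suc (toℕ π)        ≤⟨ ℕ.+-monoʳ-≤ o (ℕ.*-monoʳ-≤ 2 π<π′) ⟩
          o + 2 * toℕ π′             ≤⟨ ℕ.m≤n+m _ a′ ⟩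
          a′ + (o + 2 * toℕ π′)      ∎
          where open ℕ.≤-Reasoning

        α′≢α : α′ ℤ.- α ≢ 0ℤ
        α′≢α eq = ℕ.<⇒≢ m<m′ (sym (ℤ.+-injective (ℤ.i-j≡0⇒i≡j α′ α eq)))

        in-block : ∀ {c} π → c ≤ 1 → c + candidate β π ≤ o + r
        in-block {c} π c≤1 = begin
          c + (o + 2 * toℕ π)  ≤⟨ ℕ.+-mono-≤ c≤1 (ℕ.+-monoʳ-≤ o (2π≤2n π)) ⟩
          1 + (o + 2 * n)      ≡⟨ ℕ.+-suc o (2 * n) ⟨
          o + r                ∎
          where open ℕ.≤-Reasoning

        above : ∀ c π → o ≤ c + candidate β π
        above c π = ℕ.≤-trans (ℕ.m≤m+n o _) (ℕ.m≤n+m _ c)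

        α-close : ∣ α′ ℤ.- α ∣ ≤ r
        α-close = ∣+m-+n∣≤ (above a′ π′) (in-block π′ a′≤1) (above a π) (in-block π a≤1)

        swap : ∀ x y → (ℤ.- x) ℤ.- (ℤ.- y) ≡ y ℤ.- x
        swap = solve-∀

        b-close : ∣ (ℤ.- + b′) ℤ.- (ℤ.- + b) ∣ ≤ 1
        b-close = subst (λ z → ∣ z ∣ ≤ 1) (sym (swap (+ b′) (+ b))) (∣+m-+n∣≤ {0} z≤n b≤1 z≤n b′≤1)

      shadowed : ∀ β → Σ[ π ∈ Fin (suc n) ] Shadowed (candidate β π)
      shadowed β = byContradiction λ none → not-all-touched β λ π → pick (none ∘ (π ,_))
        (blocked (candidate β π) (ℕ.≤-trans (candidate≤ β π) (ℕ.m≤m+n _ 2)))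
        where
        pick : ∀ {m} → ¬ Shadowed m → Touched m ⊎ Shadowed m → Touched m
        pick _  (inj₁ t) = t
        pick ¬s (inj₂ s) = contradiction s ¬s

      label : ∀ {m} → Shadowed m → Fin labels
      label (k , s , s≤r , _) = combine k (ℤ→Fin s s≤r)

      -- Two blocks with the same label are shadowed by marked edges on a
      -- common line, at positions that differ by at most K.
      same-label : ∀ {m m′} (σ : Shadowed m) (σ′ : Shadowed m′) → m + 3 ≤ m′ → m′ + 2 ≤ K →
                   label σ ≢ label σ′
      same-label {m} {m′} (k , s , s≤r , t , t≤1 , Bu) (k′ , s′ , s′≤r , t′ , t′≤1 , Bu′) m+3≤m′ m′+2≤K eq
        with refl , eq′ ← Fin.combine-injective k _ k′ _ eq
        with refl ← ℤ→Fin-injective s s′ s≤r s′≤r eq′ =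
        independent (line refl (α′ ℤ.- α) apart close refl) Bu (trans (cong (λ v → B v i) shift) Bu′)
        where
        α α′ : ℤ
        α  = t ℤ.+ + m
        α′ = t′ ℤ.+ + m′

        apart : α′ ℤ.- α ≢ 0ℤ
        apart α′-α≡0 = far-apart {t} {t′} t≤1 t′≤1 m+3≤m′ (ℤ.i-j≡0⇒i≡j α′ α α′-α≡0)

        regroup : ∀ t′ m′ t m → (t′ ℤ.+ m′) ℤ.- (t ℤ.+ m) ≡ (t′ ℤ.- t) ℤ.+ (m′ ℤ.- m)
        regroup = solve-∀

        close : ∣ α′ ℤ.- α ∣ ≤ K
        close = begin
          ∣ α′ ℤ.- α ∣                             ≡⟨ cong ∣_∣ (regroup t′ (+ m′) t (+ m)) ⟩
          ∣ (t′ ℤ.- t) ℤ.+ (+ m′ ℤ.- + m) ∣        ≤⟨ ℤ.∣i+j∣≤∣i∣+∣j∣ (t′ ℤ.- t) (+ m′ ℤ.- + m) ⟩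
          ∣ t′ ℤ.- t ∣ + ∣ + m′ ℤ.- + m ∣          ≤⟨ ℕ.+-mono-≤
            (ℕ.≤-trans (ℤ.∣i-j∣≤∣i∣+∣j∣ t′ t) (ℕ.+-mono-≤ t′≤1 t≤1))
            (∣+m-+n∣≤ {0} z≤n ℕ.≤-refl z≤n (ℕ.≤-trans (ℕ.m≤m+n m 3) m+3≤m′)) ⟩
          2 + m′                                   ≡⟨ ℕ.+-comm 2 m′ ⟩
          m′ + 2                                   ≤⟨ m′+2≤K ⟩
          K                                        ∎
          where open ℕ.≤-Reasoning

        shift : axis i (α′ ℤ.- α) +ᵛ (axis k s +ᵛ axis i α) ≡ axis k s +ᵛ axis i α′
        shift = begin
          axis i (α′ ℤ.- α) +ᵛ (axis k s +ᵛ axis i α)  ≡⟨ cong (axis i (α′ ℤ.- α) +ᵛ_) (+ᵛ-comm (axis k s) _) ⟩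
          axis i (α′ ℤ.- α) +ᵛ (axis i α +ᵛ axis k s)  ≡⟨ +ᵛ-assoc (axis i (α′ ℤ.- α)) _ _ ⟨
          (axis i (α′ ℤ.- α) +ᵛ axis i α) +ᵛ axis k s  ≡⟨ cong (_+ᵛ axis k s) (axis-+ i (α′ ℤ.- α) α) ⟩
          axis i (α′ ℤ.- α ℤ.+ α) +ᵛ axis k s          ≡⟨ cong (λ z → axis i z +ᵛ axis k s) (i-j+j α′ α) ⟩
          axis i α′ +ᵛ axis k s                        ≡⟨ +ᵛ-comm (axis i α′) _ ⟩
          axis k s +ᵛ axis i α′                        ∎
          where open ≡-Reasoning

      position : Fin (suc labels) → ℕ
      position β = candidate β (proj₁ (shadowed β))

      shadow : ∀ β → Shadowed (position β)
      shadow β = proj₂ (shadowed β)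

      absurd : ⊥
      absurd =
        let β , β′ , β<β′ , eq = Fin.pigeonhole (ℕ.n<1+n labels) (λ β → label {position β} (shadow β))
        in same-label {position β} {position β′} (shadow β) (shadow β′)
             (candidate-apart (proj₁ (shadowed β)) (proj₁ (shadowed β′)) β<β′)
             (ℕ.+-monoˡ-≤ 2 (candidate≤ β′ (proj₁ (shadowed β′)))) eq

    dense : ∀ i → Σ[ t ∈ ℤ ] ∣ t ∣ ≤ D × B (axis i t) i ≡ true
    dense i = byContradiction λ none → absurd i λ t t≤D Bt → none (t , t≤D , Bt)

-- The coloring with 2n + 1 colors

module _ {n : ℕ} where

  ·-assoc : ∀ g h (x : F n) → g ·ᶠ (h ·ᶠ x) ≗ᶠ (g +ᵛ h) ·ᶠ x
  ·-assoc g h x k = cong (proj₁ x) (+ᵛ-assoc k g h)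

  ·-cong : ∀ g {x y : F n} → x ≗ᶠ y → g ·ᶠ x ≗ᶠ g ·ᶠ y
  ·-cong g x≗y k = x≗y (k +ᵛ g)

  ·-at : ∀ {g h} (x : F n) → g ≡ h → g ·ᶠ x ≗ᶠ h ·ᶠ x
  ·-at x refl k = refl

  ·-identity : ∀ (x : F n) → 0ᵛ ·ᶠ x ≗ᶠ x
  ·-identity x k = cong (proj₁ x) (+ᵛ-identityʳ k)

  ·-inverse : ∀ g {x y : F n} → y ≗ᶠ g ·ᶠ x → x ≗ᶠ (-ᵛ g) ·ᶠ y
  ·-inverse g {x} y≗gx h = sym (trans (y≗gx (h +ᵛ (-ᵛ g))) (cong (proj₁ x) (g-s+s h g)))

  -- Translating back by `h` shows that `g +ᵛ (-ᵛ h)` fixes `x`. Freeness then yields only a double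
  -- negation, removed by decidable equality of vectors.
  ·-injective : ∀ {g h} (x : F n) → g ·ᶠ x ≗ᶠ h ·ᶠ x → g ≡ h
  ·-injective {g} {h} x gx≗hx = +ᵛ-cancelʳ g h (-ᵛ h) (trans
    (decidable-stable (Vec.≡-dec ℤ._≟_ _ _) λ g-h≢0 → proj₂ x (g +ᵛ (-ᵛ h)) g-h≢0 λ k → begin
      proj₁ x (k +ᵛ (g +ᵛ (-ᵛ h)))   ≡⟨ cong (λ v → proj₁ x (k +ᵛ v)) (+ᵛ-comm g (-ᵛ h)) ⟩
      proj₁ x (k +ᵛ ((-ᵛ h) +ᵛ g))   ≡⟨ cong (proj₁ x) (+ᵛ-assoc k (-ᵛ h) g) ⟨
      proj₁ x ((k +ᵛ (-ᵛ h)) +ᵛ g)   ≡⟨ gx≗hx (k +ᵛ (-ᵛ h)) ⟩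
      proj₁ x ((k +ᵛ (-ᵛ h)) +ᵛ h)   ≡⟨ cong (proj₁ x) (g-s+s k h) ⟩
      proj₁ x k                      ∎)
    (sym (+ᵛ-inverseʳ h)))
    where open ≡-Reasoning

  axis-injective : ∀ {i j : Fin n} {t} → t ≢ 0ℤ → axis i t ≡ axis j t → i ≡ j
  axis-injective {i} {j} {t} t≢0 eq with i Fin.≟ j
  ... | yes i≡j = i≡j
  ... | no i≢j  = contradiction
    (trans (sym (lookup-axis i t)) (trans (cong (λ v → lookup v i) eq) (lookup-axis′ i≢j t))) t≢0

  edgeAt : F n → Fin n → Edge (Schreier n)
  edgeAt b i = edge (e i) (i , inj₁ refl) b

  ≈ᴱ-sym : ∀ {d d′ : Edge (Schreier n)} → _≈ᴱ_ (Schreier n) d d′ → _≈ᴱ_ (Schreier n) d′ d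
  ≈ᴱ-sym (inj₁ (p , q)) = inj₁ ((λ k → sym (p k)) , (λ k → sym (q k)))
  ≈ᴱ-sym (inj₂ (p , q)) = inj₂ ((λ k → sym (q k)) , (λ k → sym (p k)))

  ≈ᴱ-trans : ∀ {d d′ d″ : Edge (Schreier n)} → _≈ᴱ_ (Schreier n) d d′ →
             _≈ᴱ_ (Schreier n) d′ d″ → _≈ᴱ_ (Schreier n) d d″
  ≈ᴱ-trans (inj₁ (p , q)) (inj₁ (r , s)) = inj₁ ((λ k → trans (p k) (r k)) , (λ k → trans (q k) (s k)))
  ≈ᴱ-trans (inj₁ (p , q)) (inj₂ (r , s)) = inj₂ ((λ k → trans (p k) (r k)) , (λ k → trans (q k) (s k)))
  ≈ᴱ-trans (inj₂ (p , q)) (inj₁ (r , s)) = inj₂ ((λ k → trans (p k) (s k)) , (λ k → trans (q k) (r k)))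
  ≈ᴱ-trans (inj₂ (p , q)) (inj₂ (r , s)) = inj₁ ((λ k → trans (p k) (s k)) , (λ k → trans (q k) (r k)))

  isEndOf-resp : ∀ {v} {d d′ : Edge (Schreier n)} → _≈ᴱ_ (Schreier n) d d′ →
                 _isEndOf_ (Schreier n) v d → _isEndOf_ (Schreier n) v d′
  isEndOf-resp (inj₁ (p , q)) (inj₁ r) = inj₁ ((λ k → trans (r k) (p k)))
  isEndOf-resp (inj₁ (p , q)) (inj₂ r) = inj₂ ((λ k → trans (r k) (q k)))
  isEndOf-resp (inj₂ (p , q)) (inj₁ r) = inj₂ ((λ k → trans (r k) (p k)))
  isEndOf-resp (inj₂ (p , q)) (inj₂ r) = inj₁ ((λ k → trans (r k) (q k)))

  base : Edge (Schreier n) → F n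
  base (x , y , s , (i , inj₁ _) , _) = x
  base (x , y , s , (i , inj₂ _) , _) = y

  direction : Edge (Schreier n) → Fin n
  direction (x , y , s , (i , _) , _) = i

  ≈-edgeAt : ∀ d → _≈ᴱ_ (Schreier n) d (edgeAt (base d) (direction d))
  ≈-edgeAt (x , y , s , (i , inj₁ refl) , y≗sx) = inj₁ ((λ _ → refl) , y≗sx)
  ≈-edgeAt (x , y , s , (i , inj₂ refl) , y≗sx) = inj₂
    ((λ k → trans (·-inverse (-ᵛ e i) {x} {y} y≗sx k) (·-at y (-ᵛ-involutive (e i)) k))
    , λ _ → refl)

  -- An edge has only one orientation along a positive generator: the swapped case would make
  -- `e i +ᵛ e i′` zero, while its coordinate at `i` is 1 or 2.
  edgeAt-injective : ∀ {b b′ i i′} → _≈ᴱ_ (Schreier n) (edgeAt b i) (edgeAt b′ i′) → b ≗ᶠ b′ × i ≡ i′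
  edgeAt-injective {b} {b′} {i} {i′} (inj₁ (b≗b′ , eb≗eb′)) = b≗b′ ,
    axis-injective (λ ()) (·-injective {e i} {e i′} b′
      (λ k → trans (sym (b≗b′ (k +ᵛ e i))) (eb≗eb′ k)))
  edgeAt-injective {b} {b′} {i} {i′} (inj₂ (b≗eb′ , eb≗b′)) = contradiction
    (trans (sym (lookup-+ᵛ i (e i) (e i′))) (trans (cong (λ v → lookup v i) e+e≡0) (lookup-0ᵛ i)))
    (positive i i′)
    where
    e+e≡0 : e i +ᵛ e i′ ≡ 0ᵛ
    e+e≡0 = ·-injective {e i +ᵛ e i′} {0ᵛ} b′ λ k → begin
      proj₁ b′ (k +ᵛ (e i +ᵛ e i′))  ≡⟨ ·-assoc (e i) (e i′) b′ k ⟨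
      proj₁ b′ ((k +ᵛ e i) +ᵛ e i′)  ≡⟨ b≗eb′ (k +ᵛ e i) ⟨
      proj₁ b (k +ᵛ e i)             ≡⟨ eb≗b′ k ⟩
      proj₁ b′ k                     ≡⟨ ·-identity b′ k ⟨
      proj₁ b′ (k +ᵛ 0ᵛ)             ∎
      where open ≡-Reasoning
    positive : ∀ i i′ → lookup (e i) i ℤ.+ lookup (e i′) i ≢ 0ℤ
    positive i i′ eq with i Fin.≟ i′
    ... | yes refl rewrite lookup-axis i 1ℤ = contradiction eq λ ()
    ... | no i≢i′ rewrite lookup-axis i 1ℤ | lookup-axis′ i≢i′ 1ℤ = contradiction eq λ ()

  origin : ∀ i (b : F n) → axis i 0ℤ ·ᶠ b ≗ᶠ b
  origin i b k = trans (·-at b (axis-0 i) k) (·-identity b k)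

  end : ∀ {v b i} → _isEndOf_ (Schreier n) v (edgeAt b i) → Σ[ a ∈ ℕ ] a ≤ 1 × v ≗ᶠ axis i (+ a) ·ᶠ b
  end {v} {b} {i} (inj₁ v≗b) = 0 , z≤n ,
    λ k → trans (v≗b k) (sym (origin i b k))
  end (inj₂ v≗eb) = 1 , s≤s z≤n , v≗eb

  edgeAt-cong : ∀ {b b′ i i′} → b ≗ᶠ b′ → i ≡ i′ → _≈ᴱ_ (Schreier n) (edgeAt b i) (edgeAt b′ i′)
  edgeAt-cong {b} {b′} {i} b≗b′ refl = inj₁ (b≗b′ , ·-cong (e i) {b} {b′} b≗b′)

  adjacent : ∀ {a a′ i} {b b′ : F n} → a ≤ 1 → a′ ≤ 1 → axis i (+ a) ·ᶠ b ≗ᶠ axis i (+ a′) ·ᶠ b′ →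
             b ≗ᶠ b′ ⊎ b′ ≗ᶠ e i ·ᶠ b ⊎ b ≗ᶠ e i ·ᶠ b′
  adjacent {i = i} {b} {b′} z≤n z≤n p =
    inj₁ λ k → trans (sym (origin i b k)) (trans (p k) (origin i b′ k))
  adjacent {i = i} {b} {b′} z≤n (s≤s z≤n) p = inj₂ (inj₂ λ k → trans (sym (origin i b k)) (p k))
  adjacent {i = i} {b} {b′} (s≤s z≤n) z≤n p = inj₂ (inj₁ λ k → trans (sym (origin i b′ k)) (sym (p k)))
  adjacent {i = i} {b} {b′} (s≤s z≤n) (s≤s z≤n) p = inj₁ λ k → trans
    (·-inverse (e i) {b} {e i ·ᶠ b} (λ _ → refl) k)
    (trans (p (k +ᵛ (-ᵛ e i))) (sym (·-inverse (e i) {b′} {e i ·ᶠ b′} (λ _ → refl) k)))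

↔-injective : {A B : Set} (f : A ↔ B) → ∀ {a b} → Inverse.to f a ≡ Inverse.to f b → a ≡ b
↔-injective f eq = trans (sym (Inverse.strictlyInverseʳ f _))
  (trans (cong (Inverse.from f) eq) (Inverse.strictlyInverseʳ f _))

-- Two colors for each direction, and one extra color.
Color : ℕ → Set
Color n = (Bool × Fin n) ⊎ Fin 1

palette : ∀ n → Color n ↔ Fin (2 * n + 1)
palette n = ↔-sym ((((Fin.2↔Bool ×-↔ ↔-id _) ↔-∘ Fin.*↔×) ⊎-↔ ↔-id _) ↔-∘ Fin.+↔⊎)

tint : ∀ {n} → Bool → Bool → Fin n → Color n
tint true  _ _ = inj₂ zero
tint false p i = inj₁ (p , i)

tint-≡ : ∀ {n} a a′ {p p′} {i i′ : Fin n} → tint a p i ≡ tint a′ p′ i′ →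
         (a ≡ true × a′ ≡ true) ⊎ (a ≡ false × a′ ≡ false × p ≡ p′ × i ≡ i′)
tint-≡ true  true  _    = inj₁ (refl , refl)
tint-≡ false false refl = inj₂ (refl , refl , refl , refl)

module Coloring (n D : ℕ)
  (marked : F n → Fin n → Bool) (marked-LC : ∀ i → LocallyConstant (λ x → marked x i))
  (not-consecutive : ∀ {x i} → marked x i ≡ true → marked (e i ·ᶠ x) i ≢ true)
  (not-touching : ∀ {x i j a b} → i ≢ j → a ≤ 1 → b ≤ 1 → marked x i ≡ true →
                  marked ((axis i (+ a) +ᵛ axis j (ℤ.- + b)) ·ᶠ x) j ≢ true)
  (dense : ∀ x i → Σ[ t ∈ ℤ ] ∣ t ∣ ≤ D × marked (axis i t ·ᶠ x) i ≡ true)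
  where

  -- parity m i x is the parity of the number of steps from x back to the
  -- nearest marked edge in direction i, if fewer than m steps suffice.
  parity : ℕ → Fin n → F n → Bool
  parity zero    i x = false
  parity (suc m) i x = if marked x i then false else not (parity m i (axis i -1ℤ ·ᶠ x))

  parity-LC : ∀ m i → LocallyConstant (parity m i)
  parity-LC zero    i = LC-const false
  parity-LC (suc m) i = LC-bind
    {g = λ a x → if a then false else not (parity m i (axis i -1ℤ ·ᶠ x))} (marked-LC i) λ where
      true  → LC-const false
      false → LC-map not (LC-shift (parity-LC m i) (axis i -1ℤ))

  parity-stable : ∀ d i x {m m′} → marked (axis i (ℤ.- + d) ·ᶠ x) i ≡ true → d < m → d < m′ →
                  parity m i x ≡ parity m′ i x
  parity-stable d i x {suc m} {suc m′} hit (s≤s d≤m) (s≤s d≤m′) with marked x i in eq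
  ... | true  = refl
  ... | false = cong not (step d hit d≤m d≤m′)
    where
    step : ∀ d → marked (axis i (ℤ.- + d) ·ᶠ x) i ≡ true → d ≤ m → d ≤ m′ →
           parity m i (axis i -1ℤ ·ᶠ x) ≡ parity m′ i (axis i -1ℤ ·ᶠ x)
    step zero hit _ _ = contradiction
      (trans (sym eq) (trans (sym (trans (LC-at (marked-LC i) x (axis-0 i)) (LC-0 (marked-LC i) x))) hit)) λ ()
    step (suc d) hit d<m d<m′ = parity-stable d i (axis i -1ℤ ·ᶠ x)
      (trans (LC-shift² (marked-LC i) (axis i (ℤ.- + d)) (axis i -1ℤ) x)
        (trans (LC-at (marked-LC i) x (trans (axis-+ i (ℤ.- + d) -1ℤ) (cong (axis i) pred))) hit)) d<m d<m′
      where
      pred : ℤ.- + d ℤ.+ -1ℤ ≡ ℤ.- + suc d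
      pred = trans (sym (ℤ.neg-distrib-+ (+ d) 1ℤ)) (cong (λ k → ℤ.- + k) (ℕ.+-comm d 1))

  hit-behind : ∀ x i → Σ[ d ∈ ℕ ] d ≤ D + D × marked (axis i (ℤ.- + d) ·ᶠ x) i ≡ true
  -- Density is applied `D` steps behind `x`, so the marked edge found has offset `t - D`, between
  -- `-2D` and 0, and is never ahead of `x`.
  hit-behind x i with t , t≤D , hit ← dense (axis i (ℤ.- + D) ·ᶠ x) i =
    ∣ + D ℤ.- t ∣ , ℕ.≤-trans (ℤ.∣i-j∣≤∣i∣+∣j∣ (+ D) t) (ℕ.+-monoʳ-≤ D t≤D) ,
    trans (LC-at (marked-LC i) x (cong (axis i) (trans (cong ℤ.-_ abs) neg)))
      (trans (sym (trans (LC-shift² (marked-LC i) (axis i t) (axis i (ℤ.- + D)) x)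
        (LC-at (marked-LC i) x (axis-+ i t (ℤ.- + D))))) hit)
    where
    ≤∣∣ : ∀ t → t ℤ.≤ + ∣ t ∣
    ≤∣∣ (+ _)    = ℤ.≤-refl
    ≤∣∣ -[1+ _ ] = ℤ.-≤+
    t≤+D : t ℤ.≤ + D
    t≤+D = ℤ.≤-trans (≤∣∣ t) (ℤ.+≤+ t≤D)
    abs : + ∣ + D ℤ.- t ∣ ≡ + D ℤ.- t
    abs = ℤ.0≤i⇒+∣i∣≡i (ℤ.i≤j⇒0≤j-i t≤+D)
    neg : ℤ.- (+ D ℤ.- t) ≡ t ℤ.- + D
    neg = trans (ℤ.neg-distrib-+ (+ D) (ℤ.- t)) (trans (ℤ.+-comm (ℤ.- + D) _) (cong (ℤ._+ (ℤ.- + D)) (ℤ.neg-involutive t)))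

  -- From `x` the search backwards needs at most `D + D` steps, hence fuel `D + D + 1`; one more
  -- unit pays for the step from `e i ·ᶠ x` to `x`.
  fuel : ℕ
  fuel = suc (suc (D + D))

  parity-flips : ∀ x i → marked (e i ·ᶠ x) i ≡ false → parity fuel i (e i ·ᶠ x) ≡ not (parity fuel i x)
  parity-flips x i unmarked with d , d≤2D , hit ← hit-behind x i = begin
    parity fuel i (e i ·ᶠ x)                                     ≡⟨ cong (λ a → if a then false else not (parity m i y)) unmarked ⟩
    not (parity m i (axis i -1ℤ ·ᶠ (e i ·ᶠ x)))                  ≡⟨ cong not (LC-shift² (parity-LC m i) (axis i -1ℤ) (e i) x) ⟩
    not (parity m i ((axis i -1ℤ +ᵛ e i) ·ᶠ x))                  ≡⟨ cong not (LC-at (parity-LC m i) x (trans (axis-+ i -1ℤ 1ℤ) (axis-0 i))) ⟩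
    not (parity m i (0ᵛ ·ᶠ x))                                   ≡⟨ cong not (LC-0 (parity-LC m i) x) ⟩
    not (parity m i x)                                           ≡⟨ cong not (parity-stable d i x hit (s≤s d≤2D) (s≤s (ℕ.m≤n⇒m≤1+n d≤2D))) ⟩
    not (parity fuel i x)                                        ∎
    where
    open ≡-Reasoning
    m : ℕ
    m = suc (D + D)
    y : F n
    y = axis i -1ℤ ·ᶠ (e i ·ᶠ x)

  paint : F n → Fin n → Color n
  paint x i = tint (marked x i) (parity fuel i x) i

  paint-LC : ∀ i → LocallyConstant (λ x → paint x i)
  paint-LC i = LC-bind {g = λ a x → tint a (parity fuel i x) i} (marked-LC i) λ where
    true  → LC-const (inj₂ zero)
    false → LC-map (λ p → inj₁ (p , i)) (parity-LC fuel i)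

  parity-adjacent : ∀ {b b′ i} → marked b′ i ≡ false → b′ ≗ᶠ e i ·ᶠ b →
                    parity fuel i b ≢ parity fuel i b′
  parity-adjacent {b} {b′} {i} unmarked b′≗eb eq = Bool.not-¬ refl (sym (begin
    not (parity fuel i b)     ≡⟨ parity-flips b i (trans (sym (LC-cong (marked-LC i) {b′} {e i ·ᶠ b} b′≗eb)) unmarked) ⟨
    parity fuel i (e i ·ᶠ b)  ≡⟨ LC-cong (parity-LC fuel i) {b′} {e i ·ᶠ b} b′≗eb ⟨
    parity fuel i b′          ≡⟨ eq ⟨
    parity fuel i b           ∎))
    where open ≡-Reasoning

  marked-adjacent : ∀ {b b′ i} → marked b i ≡ true → marked b′ i ≡ true → ¬ (b′ ≗ᶠ e i ·ᶠ b)
  marked-adjacent {b} {b′} {i} mb mb′ b′≗eb = not-consecutive mb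
    (trans (sym (LC-cong (marked-LC i) {b′} {e i ·ᶠ b} b′≗eb)) mb′)

  -- Here b and b′ are the bases of two edges that share a vertex.
  paint-proper : ∀ {b b′ i i′ a a′} → a ≤ 1 → a′ ≤ 1 →
                 axis i (+ a) ·ᶠ b ≗ᶠ axis i′ (+ a′) ·ᶠ b′ → ¬ (b ≗ᶠ b′ × i ≡ i′) →
                 paint b i ≢ paint b′ i′
  paint-proper {b} {b′} {i} {i′} {a} {a′} a≤1 a′≤1 meet distinct eq
    with tint-≡ (marked b i) (marked b′ i′) eq
  ... | inj₁ (mb , mb′) with i Fin.≟ i′
  ...   | no i≢i′ = not-touching i≢i′ a≤1 a′≤1 mb
    (trans (LC-cong (marked-LC i′) {(axis i (+ a) +ᵛ axis i′ (ℤ.- + a′)) ·ᶠ b} {b′} λ k → begin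
      proj₁ b (k +ᵛ (axis i (+ a) +ᵛ axis i′ (ℤ.- + a′)))    ≡⟨ cong (λ v → proj₁ b (k +ᵛ v)) (+ᵛ-comm (axis i (+ a)) _) ⟩
      proj₁ b (k +ᵛ (axis i′ (ℤ.- + a′) +ᵛ axis i (+ a)))    ≡⟨ ·-assoc (axis i′ (ℤ.- + a′)) (axis i (+ a)) b k ⟨
      proj₁ b ((k +ᵛ axis i′ (ℤ.- + a′)) +ᵛ axis i (+ a))    ≡⟨ cong (λ v → proj₁ b ((k +ᵛ v) +ᵛ axis i (+ a))) (axis-neg i′ (+ a′)) ⟨
      proj₁ b ((k +ᵛ (-ᵛ axis i′ (+ a′))) +ᵛ axis i (+ a))   ≡⟨ ·-inverse (axis i′ (+ a′)) {b′} {axis i (+ a) ·ᶠ b} meet k ⟨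
      proj₁ b′ k                                             ∎) mb′)
    where open ≡-Reasoning
  ...   | yes refl with adjacent {a = a} {a′} {i} {b} {b′} a≤1 a′≤1 meet
  ...     | inj₁ b≗b′           = distinct (b≗b′ , refl)
  ...     | inj₂ (inj₁ b′≗eb)   = marked-adjacent {b} {b′} mb mb′ b′≗eb
  ...     | inj₂ (inj₂ b≗eb′)   = marked-adjacent {b′} {b} mb′ mb b≗eb′
  paint-proper {b} {b′} {i} {i′} {a} {a′} a≤1 a′≤1 meet distinct eq
      | inj₂ (mb , mb′ , same , refl)
    with adjacent {a = a} {a′} {i} {b} {b′} a≤1 a′≤1 meet
  ... | inj₁ b≗b′           = distinct (b≗b′ , refl)
  ... | inj₂ (inj₁ b′≗eb)   = parity-adjacent {b} {b′} mb′ b′≗eb same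
  ... | inj₂ (inj₂ b≗eb′)   = parity-adjacent {b′} {b} mb b≗eb′ (sym same)

  paint-≈ : ∀ {d d′} → _≈ᴱ_ (Schreier n) d d′ →
            paint (base d) (direction d) ≡ paint (base d′) (direction d′)
  paint-≈ {d} {d′} d≈d′
    with b≗b′ , refl ← edgeAt-injective {b = base d} {base d′} {direction d} {direction d′}
      (≈ᴱ-trans {d = edgeAt (base d) (direction d)} {d} {edgeAt (base d′) (direction d′)}
        (≈ᴱ-sym {d = d} {edgeAt (base d) (direction d)} (≈-edgeAt d))
        (≈ᴱ-trans {d = d} {d′} {edgeAt (base d′) (direction d′)} d≈d′ (≈-edgeAt d′))) =
    LC-cong (paint-LC (direction d)) {base d} {base d′} b≗b′

  coloring : EdgeColoring (Schreier n) (Fin (2 * n + 1))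
  coloring = record
    { color      = λ d → Inverse.to (palette n) (paint (base d) (direction d))
    ; color-cong = λ {d} {d′} d≈d′ → cong (Inverse.to (palette n)) (paint-≈ {d} {d′} d≈d′)
    }

  proper : IsProper (Schreier n) coloring
  proper d d′ d≉d′ (v , v∈d , v∈d′) eq
    with a , a≤1 , v≗ ← end {v = v} {base d} {direction d} (isEndOf-resp {v = v} {d} {edgeAt (base d) (direction d)} (≈-edgeAt d) v∈d)
       | a′ , a′≤1 , v≗′ ← end {v = v} {base d′} {direction d′} (isEndOf-resp {v = v} {d′} {edgeAt (base d′) (direction d′)} (≈-edgeAt d′) v∈d′) =
    paint-proper {base d} {base d′} {direction d} {direction d′} {a} {a′} a≤1 a′≤1
      (λ k → trans (sym (v≗ k)) (v≗′ k))
      (λ (b≗b′ , i≡i′) → d≉d′ (≈ᴱ-trans {d = d} {edgeAt (base d) (direction d)} {d′} (≈-edgeAt d)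
        (≈ᴱ-trans {d = edgeAt (base d) (direction d)} {edgeAt (base d′) (direction d′)} {d′}
          (edgeAt-cong {b = base d} {base d′} b≗b′ i≡i′)
          (≈ᴱ-sym {d = d′} {edgeAt (base d′) (direction d′)} (≈-edgeAt d′)))))
      (↔-injective (palette n) eq)

  continuous : IsContinuousColoring coloring
  continuous s (i , inj₁ _) = LC⇒continuous (LC-map (Inverse.to (palette n)) (paint-LC i))
  continuous s (i , inj₂ _) = LC⇒continuous (LC-map (Inverse.to (palette n)) (LC-shift (paint-LC i) s))

upper-bound : ExcludedMiddle 0ℓ → ∀ n → HasContinuousProperEdgeColoring n (Fin (2 * n + 1))
upper-bound em n = coloring , proper , continuous
  where
  open ConflictDefs n
  open Classical em
  open Priority n (K + suc r)
  open MaximalIndependent n (K + suc r) priority priority-LC priority-separates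
    Conflict conflict-bounded conflict-sym conflict-irrefl

  dense : ∀ x i → Σ[ t ∈ ℤ ] ∣ t ∣ ≤ D × chosen (axis i t ·ᶠ x) i ≡ true
  dense x = Density.dense em (λ g j → chosen (g ·ᶠ x) j)
    (λ {u} {i} {g} {j} c Bu Bgu → chosen-independent c Bu (trans (LC-shift² (chosen-LC j) g u x) Bgu))
    (λ u i Bu → let g , j , c , A = chosen-maximal (u ·ᶠ x) i Bu in
      g , j , c , trans (sym (LC-shift² (chosen-LC j) g u x)) A)

  1≤K : 1 ≤ K
  1≤K = ℕ.≤-trans (s≤s z≤n) (ℕ.m≤n+m 2 (labels * w + 2 * n))

  open Coloring n D chosen chosen-LC
    (chosen-independent (line refl 1ℤ (λ ()) 1≤K refl))
    (λ i≢j a≤1 b≤1 → chosen-independent (touch i≢j _ _ a≤1 b≤1 refl))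
    dense

-- A hyperaperiodic point

digit : ℕ → Bool → Bool
digit 0 b = b
digit 1 _ = true
digit 2 _ = false
digit 3 _ = false
digit _ _ = true

-- `f` is fuel: dividing out a final zero digit makes a nonzero `h` smaller in absolute value, so
-- fuel `∣ h ∣` reaches the last nonzero digit. The value `true` at exhausted fuel becomes the value
-- at 0, which has no nonzero digit.
toeplitz′ : ℕ → ℤ → Bool
toeplitz′ zero    h = true
toeplitz′ (suc f) h = digit (h %ℕ 5) (toeplitz′ f (h /ℕ 5))

-- The value at h depends on whether the last nonzero digit of h in base 5 is a
-- square modulo 5.
toeplitz : ℤ → Bool
toeplitz h = toeplitz′ ∣ h ∣ h

∣digit-shift∣ : ∀ {m n} → m < 5 → n < 5 → ∣ + m ℤ.- + n ∣ ≤ 4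
∣digit-shift∣ m<5 n<5 = ∣+m-+n∣≤ {0} z≤n (ℕ.≤-pred m<5) z≤n (ℕ.≤-pred n<5)

∣i*5∣ : ∀ i → ∣ i ℤ.* + 5 ∣ ≡ ∣ i ∣ * 5
∣i*5∣ i = ℤ.abs-* i (+ 5)

split-unique : ∀ {q q′ r r′} → r < 5 → r′ < 5 → + r ℤ.+ q ℤ.* + 5 ≡ + r′ ℤ.+ q′ ℤ.* + 5 → r ≡ r′ × q ≡ q′
split-unique {q} {q′} {r} {r′} r<5 r′<5 eq = r≡r′ , q≡q′
  where
  move : ∀ r q r′ q′ → r ℤ.+ q ℤ.* + 5 ≡ r′ ℤ.+ q′ ℤ.* + 5 → (q ℤ.- q′) ℤ.* + 5 ≡ r′ ℤ.- r
  move r q r′ q′ eq = begin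
    (q ℤ.- q′) ℤ.* + 5                              ≡⟨ lhs r q q′ ⟩
    (r ℤ.+ q ℤ.* + 5) ℤ.- (r ℤ.+ q′ ℤ.* + 5)         ≡⟨ cong (ℤ._- (r ℤ.+ q′ ℤ.* + 5)) eq ⟩
    (r′ ℤ.+ q′ ℤ.* + 5) ℤ.- (r ℤ.+ q′ ℤ.* + 5)       ≡⟨ rhs r r′ q′ ⟩
    r′ ℤ.- r                                        ∎
    where
    open ≡-Reasoning
    lhs : ∀ r q q′ → (q ℤ.- q′) ℤ.* + 5 ≡ (r ℤ.+ q ℤ.* + 5) ℤ.- (r ℤ.+ q′ ℤ.* + 5)
    lhs = solve-∀
    rhs : ∀ r r′ q′ → (r′ ℤ.+ q′ ℤ.* + 5) ℤ.- (r ℤ.+ q′ ℤ.* + 5) ≡ r′ ℤ.- r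
    rhs = solve-∀

  small : ∣ q ℤ.- q′ ∣ * 5 < 1 * 5
  small = begin-strict
    ∣ q ℤ.- q′ ∣ * 5           ≡⟨ ∣i*5∣ (q ℤ.- q′) ⟨
    ∣ (q ℤ.- q′) ℤ.* + 5 ∣     ≡⟨ cong ∣_∣ (move (+ r) q (+ r′) q′ eq) ⟩
    ∣ + r′ ℤ.- + r ∣           <⟨ s≤s (∣digit-shift∣ r′<5 r<5) ⟩
    5                          ∎
    where open ℕ.≤-Reasoning

  q≡q′ : q ≡ q′
  q≡q′ = ℤ.i-j≡0⇒i≡j q q′ (ℤ.∣i∣≡0⇒i≡0 (ℕ.n<1⇒n≡0 (ℕ.*-cancelʳ-< _ _ _ small)))

  r≡r′ : r ≡ r′
  r≡r′ = ℤ.+-injective (∙-cancelʳ (q ℤ.* + 5) _ _ (trans eq (cong (λ z → + r′ ℤ.+ z ℤ.* + 5) (sym q≡q′))))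

record Split (h : ℤ) : Set where
  constructor split
  field
    remainder : ℕ
    quotient  : ℤ
    small     : remainder < 5
    value     : h ≡ + remainder ℤ.+ quotient ℤ.* + 5

splitting : ∀ h → Split h
splitting h = split (h %ℕ 5) (h /ℕ 5) (n%ℕd<d h 5) (a≡a%ℕn+[a/ℕn]*n h 5)

toeplitz-0 : ∀ f → toeplitz′ f 0ℤ ≡ true
toeplitz-0 zero    = refl
toeplitz-0 (suc f) = toeplitz-0 f

digit-nonzero : ∀ r b c → r ≢ 0 → digit r b ≡ digit r c
digit-nonzero 0 _ _ r≢0 = contradiction refl r≢0
digit-nonzero 1 _ _ _ = refl
digit-nonzero 2 _ _ _ = refl
digit-nonzero 3 _ _ _ = refl
digit-nonzero (suc (suc (suc (suc _)))) _ _ _ = refl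

quotient-smaller : ∀ q → q ≢ 0ℤ → ∣ q ∣ < ∣ q ℤ.* + 5 ∣
quotient-smaller q q≢0 = begin-strict
  ∣ q ∣              <⟨ ℕ.m<m*n ∣ q ∣ 5 {{ℤ.≢-nonZero q≢0}} (s≤s (s≤s z≤n)) ⟩
  ∣ q ∣ * 5          ≡⟨ ∣i*5∣ q ⟨
  ∣ q ℤ.* + 5 ∣      ∎
  where open ℕ.≤-Reasoning

toeplitz-stable : ∀ f f′ h → ∣ h ∣ ≤ f → ∣ h ∣ ≤ f′ → toeplitz′ f h ≡ toeplitz′ f′ h
toeplitz-stable zero f′ h h≤0 _ with refl ← ℤ.∣i∣≡0⇒i≡0 {h} (ℕ.n≤0⇒n≡0 h≤0) = sym (toeplitz-0 f′)
toeplitz-stable (suc f) zero h _ h≤0 with refl ← ℤ.∣i∣≡0⇒i≡0 {h} (ℕ.n≤0⇒n≡0 h≤0) = toeplitz-0 (suc f)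
toeplitz-stable (suc f) (suc f′) h h≤f h≤f′ with h %ℕ 5 in eq
... | suc r = digit-nonzero (suc r) _ _ λ ()
... | zero with h /ℕ 5 ℤ.≟ 0ℤ
...   | yes q≡0 rewrite q≡0 = trans (toeplitz-0 f) (sym (toeplitz-0 f′))
...   | no q≢0 = toeplitz-stable f f′ (h /ℕ 5)
  (ℕ.≤-pred (ℕ.<-≤-trans smaller h≤f)) (ℕ.≤-pred (ℕ.<-≤-trans smaller h≤f′))
  where
  smaller : ∣ h /ℕ 5 ∣ < ∣ h ∣
  smaller = subst (λ z → ∣ h /ℕ 5 ∣ < ∣ z ∣)
    (sym (trans (a≡a%ℕn+[a/ℕn]*n h 5) (trans (cong (λ r → + r ℤ.+ h /ℕ 5 ℤ.* + 5) eq) (ℤ.+-identityˡ (h /ℕ 5 ℤ.* + 5)))))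
    (quotient-smaller (h /ℕ 5) q≢0)

toeplitz-step : ∀ r q → r < 5 → toeplitz (+ r ℤ.+ q ℤ.* + 5) ≡ digit r (toeplitz q)
toeplitz-step r q r<5 = begin
  toeplitz′ ∣ h ∣ h                  ≡⟨ toeplitz-stable ∣ h ∣ (suc (∣ h ∣ + ∣ q ∣)) h ℕ.≤-refl (ℕ.m≤n⇒m≤1+n (ℕ.m≤m+n _ _)) ⟩
  digit (h %ℕ 5) (toeplitz′ f (h /ℕ 5))  ≡⟨ cong₂ (λ r q → digit r (toeplitz′ f q)) (proj₁ same) (proj₂ same) ⟩
  digit r (toeplitz′ f q)            ≡⟨ cong (digit r) (toeplitz-stable f ∣ q ∣ q (ℕ.m≤n+m _ ∣ h ∣) ℕ.≤-refl) ⟩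
  digit r (toeplitz q)               ∎
  where
  open ≡-Reasoning
  h : ℤ
  h = + r ℤ.+ q ℤ.* + 5
  f : ℕ
  f = ∣ h ∣ + ∣ q ∣
  same : h %ℕ 5 ≡ r × h /ℕ 5 ≡ q
  same = split-unique {h /ℕ 5} {q} (n%ℕd<d h 5) r<5 (sym (a≡a%ℕn+[a/ℕn]*n h 5))

-- A nonzero `h` of this size has its last nonzero digit below position `k`, where adding `5 ^ k`
-- changes nothing. For `h = 0` the last nonzero digit becomes 1, a square, in accordance with the
-- value `true` at 0.
toeplitz-recurrent : ∀ k h → ∣ h ∣ < 5 ^ k → toeplitz (h ℤ.+ + (5 ^ k)) ≡ toeplitz h
toeplitz-recurrent zero h h<1 with refl ← ℤ.∣i∣≡0⇒i≡0 {h} (ℕ.n<1⇒n≡0 h<1) = refl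
toeplitz-recurrent (suc k) h h<5^ with split r q r<5 refl ← splitting h = begin
  toeplitz ((+ r ℤ.+ q ℤ.* + 5) ℤ.+ + (5 * 5 ^ k))     ≡⟨ cong (λ z → toeplitz ((+ r ℤ.+ q ℤ.* + 5) ℤ.+ z)) (ℤ.pos-* 5 (5 ^ k)) ⟩
  toeplitz ((+ r ℤ.+ q ℤ.* + 5) ℤ.+ + 5 ℤ.* + (5 ^ k)) ≡⟨ cong toeplitz (regroup (+ r) q (+ (5 ^ k))) ⟩
  toeplitz (+ r ℤ.+ (q ℤ.+ + (5 ^ k)) ℤ.* + 5)         ≡⟨ toeplitz-step r (q ℤ.+ + (5 ^ k)) r<5 ⟩
  digit r (toeplitz (q ℤ.+ + (5 ^ k)))                 ≡⟨ quotients r h<5^ ⟩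
  digit r (toeplitz q)                                 ≡⟨ toeplitz-step r q r<5 ⟨
  toeplitz (+ r ℤ.+ q ℤ.* + 5)                         ∎
  where
  open ≡-Reasoning
  regroup : ∀ r q s → (r ℤ.+ q ℤ.* + 5) ℤ.+ + 5 ℤ.* s ≡ r ℤ.+ (q ℤ.+ s) ℤ.* + 5
  regroup = solve-∀
  quotients : ∀ r → ∣ + r ℤ.+ q ℤ.* + 5 ∣ < 5 * 5 ^ k →
              digit r (toeplitz (q ℤ.+ + (5 ^ k))) ≡ digit r (toeplitz q)
  quotients zero h<5^ = toeplitz-recurrent k q (ℕ.*-cancelʳ-< _ _ _ (subst₂ _<_
    (trans (cong ∣_∣ (ℤ.+-identityˡ (q ℤ.* + 5))) (∣i*5∣ q)) (ℕ.*-comm 5 (5 ^ k)) h<5^))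
  quotients (suc r) _ = digit-nonzero (suc r) _ _ λ ()

-- Aperiodicity asks only for `b = true`. Both values are demanded because in several dimensions the
-- other coordinates contribute a bit that has to be compensated.
Toggles : ∀ {n} → 2^ℤ^ n → ℤ^ n → Set
Toggles {n} x g = Σ[ N ∈ ℕ ] (∀ h b → Σ[ t ∈ ℤ^ n ] ∥ t ∥ ≤ N × x (t +ᵛ h) xor x ((t +ᵛ g) +ᵛ h) ≡ b)

Toggles₁ : (ℤ → Bool) → ℤ → Set
Toggles₁ x g = Σ[ N ∈ ℕ ] (∀ h b → Σ[ t ∈ ℤ ] ∣ t ∣ ≤ N × x (t ℤ.+ h) xor x ((t ℤ.+ g) ℤ.+ h) ≡ b)

-- For s ≢ 0 mod 5 there are nonzero residues d and d + s which are both
-- squares or both non-squares (b = false), or of different kinds (b = true).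
residues : ∀ s → s < 5 → s ≢ 0 → ∀ b → Σ[ d ∈ ℕ ] Σ[ d′ ∈ ℕ ] Σ[ c ∈ ℕ ]
           d < 5 × d′ < 5 × d + s ≡ d′ + c * 5 × (∀ u v → digit d u xor digit d′ v ≡ b)
residues = λ where
    0 _ s≢0 → contradiction refl s≢0
    1 _ _ true  → 1 , 2 , 0 , ℕ.≤ᵇ⇒≤ _ _ tt , ℕ.≤ᵇ⇒≤ _ _ tt , refl , λ _ _ → refl
    1 _ _ false → 2 , 3 , 0 , ℕ.≤ᵇ⇒≤ _ _ tt , ℕ.≤ᵇ⇒≤ _ _ tt , refl , λ _ _ → refl
    2 _ _ true  → 2 , 4 , 0 , ℕ.≤ᵇ⇒≤ _ _ tt , ℕ.≤ᵇ⇒≤ _ _ tt , refl , λ _ _ → refl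
    2 _ _ false → 4 , 1 , 1 , ℕ.≤ᵇ⇒≤ _ _ tt , ℕ.≤ᵇ⇒≤ _ _ tt , refl , λ _ _ → refl
    3 _ _ true  → 4 , 2 , 1 , ℕ.≤ᵇ⇒≤ _ _ tt , ℕ.≤ᵇ⇒≤ _ _ tt , refl , λ _ _ → refl
    3 _ _ false → 1 , 4 , 0 , ℕ.≤ᵇ⇒≤ _ _ tt , ℕ.≤ᵇ⇒≤ _ _ tt , refl , λ _ _ → refl
    4 _ _ true  → 2 , 1 , 1 , ℕ.≤ᵇ⇒≤ _ _ tt , ℕ.≤ᵇ⇒≤ _ _ tt , refl , λ _ _ → refl
    4 _ _ false → 3 , 2 , 1 , ℕ.≤ᵇ⇒≤ _ _ tt , ℕ.≤ᵇ⇒≤ _ _ tt , refl , λ _ _ → refl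
    (suc (suc (suc (suc (suc s))))) s<5 → contradiction s<5 (ℕ.≤⇒≯ (ℕ.m≤m+n 5 s))

-- If 5 divides `g`, choose the translate so that both positions are multiples of 5, where the
-- sequence repeats itself with `g` divided by 5; a bound `N` becomes `N * 5 + 4`. Otherwise
-- `residues` prescribes two nonzero last digits, which settle both values at once.
toeplitz-toggles : ∀ g → g ≢ 0ℤ → Toggles₁ toeplitz g
toeplitz-toggles g = <-rec (λ m → ∀ g → ∣ g ∣ ≡ m → g ≢ 0ℤ → Toggles₁ toeplitz g) step ∣ g ∣ g refl
  where
  open ≡-Reasoning
  step : ∀ m → (∀ {k} → k < m → ∀ g → ∣ g ∣ ≡ k → g ≢ 0ℤ → Toggles₁ toeplitz g) →
         ∀ g → ∣ g ∣ ≡ m → g ≢ 0ℤ → Toggles₁ toeplitz g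
  step m rec g refl g≢0 with splitting g
  ... | split zero g′ _ refl
    with N , toggle ← rec (subst (λ z → ∣ g′ ∣ < ∣ z ∣) (sym (ℤ.+-identityˡ (g′ ℤ.* + 5)))
           (quotient-smaller g′ λ { refl → g≢0 refl })) g′ refl (λ { refl → g≢0 refl }) =
    N * 5 + 4 , λ h b → let split r q r<5 h≡ = splitting h
                            t , t≤N , eq = toggle q b in
      t ℤ.* + 5 ℤ.- + r ,
      ℕ.≤-trans (ℤ.∣i-j∣≤∣i∣+∣j∣ (t ℤ.* + 5) (+ r))
        (ℕ.+-mono-≤ (ℕ.≤-trans (ℕ.≤-reflexive (∣i*5∣ t)) (ℕ.*-monoˡ-≤ 5 t≤N)) (ℕ.≤-pred r<5)) ,
      trans (cong₂ _xor_
        (trans (cong toeplitz (trans (cong (λ z → t ℤ.* + 5 ℤ.- + r ℤ.+ z) h≡) (lhs t (+ r) q))) (toeplitz-step 0 (t ℤ.+ q) (s≤s z≤n)))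
        (trans (cong toeplitz (trans (cong (λ z → t ℤ.* + 5 ℤ.- + r ℤ.+ (+ 0 ℤ.+ g′ ℤ.* + 5) ℤ.+ z) h≡) (rhs t (+ r) q g′)))
          (toeplitz-step 0 (t ℤ.+ g′ ℤ.+ q) (s≤s z≤n)))) eq
    where
    lhs : ∀ t r q → (t ℤ.* + 5 ℤ.- r) ℤ.+ (r ℤ.+ q ℤ.* + 5) ≡ + 0 ℤ.+ (t ℤ.+ q) ℤ.* + 5
    lhs = solve-∀
    rhs : ∀ t r q g → ((t ℤ.* + 5 ℤ.- r) ℤ.+ (+ 0 ℤ.+ g ℤ.* + 5)) ℤ.+ (r ℤ.+ q ℤ.* + 5) ≡ + 0 ℤ.+ (t ℤ.+ g ℤ.+ q) ℤ.* + 5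
    rhs = solve-∀
  ... | split s@(suc _) g′ s<5 refl = 4 , λ h b →
    let split r q r<5 h≡ = splitting h
        d , d′ , c , d<5 , d′<5 , carry , eq = residues s s<5 (λ ()) b in
      + d ℤ.- + r , ∣digit-shift∣ d<5 r<5 ,
      trans (cong₂ _xor_
        (trans (cong toeplitz (trans (cong (λ z → + d ℤ.- + r ℤ.+ z) h≡) (lhs (+ d) (+ r) q))) (toeplitz-step d q d<5))
        (trans (cong toeplitz (trans (cong (λ z → + d ℤ.- + r ℤ.+ (+ s ℤ.+ g′ ℤ.* + 5) ℤ.+ z) h≡)
            (carrying d s d′ c (+ r) q g′ carry)))
          (toeplitz-step d′ (q ℤ.+ g′ ℤ.+ + c) d′<5))) (eq _ _)
    where
    lhs : ∀ d r q → (d ℤ.- r) ℤ.+ (r ℤ.+ q ℤ.* + 5) ≡ d ℤ.+ q ℤ.* + 5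
    lhs = solve-∀
    mid : ∀ d s r q g → ((d ℤ.- r) ℤ.+ (s ℤ.+ g ℤ.* + 5)) ℤ.+ (r ℤ.+ q ℤ.* + 5) ≡ (d ℤ.+ s) ℤ.+ (q ℤ.+ g) ℤ.* + 5
    mid = solve-∀
    rhs : ∀ d′ c q g → (d′ ℤ.+ c ℤ.* + 5) ℤ.+ (q ℤ.+ g) ℤ.* + 5 ≡ d′ ℤ.+ (q ℤ.+ g ℤ.+ c) ℤ.* + 5
    rhs = solve-∀
    carrying : ∀ d s d′ c r q g → d + s ≡ d′ + c * 5 →
               ((+ d ℤ.- r) ℤ.+ (+ s ℤ.+ g ℤ.* + 5)) ℤ.+ (r ℤ.+ q ℤ.* + 5) ≡ + d′ ℤ.+ (q ℤ.+ g ℤ.+ + c) ℤ.* + 5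
    carrying d s d′ c r q g carry = begin
      ((+ d ℤ.- r) ℤ.+ (+ s ℤ.+ g ℤ.* + 5)) ℤ.+ (r ℤ.+ q ℤ.* + 5)  ≡⟨ mid (+ d) (+ s) r q g ⟩
      + (d + s) ℤ.+ (q ℤ.+ g) ℤ.* + 5                              ≡⟨ cong (λ z → + z ℤ.+ (q ℤ.+ g) ℤ.* + 5) carry ⟩
      (+ d′ ℤ.+ + (c * 5)) ℤ.+ (q ℤ.+ g) ℤ.* + 5                   ≡⟨ cong (λ z → (+ d′ ℤ.+ z) ℤ.+ (q ℤ.+ g) ℤ.* + 5) (ℤ.pos-* c 5) ⟩
      (+ d′ ℤ.+ + c ℤ.* + 5) ℤ.+ (q ℤ.+ g) ℤ.* + 5                 ≡⟨ rhs (+ d′) (+ c) q g ⟩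
      + d′ ℤ.+ (q ℤ.+ g ℤ.+ + c) ℤ.* + 5                           ∎

-- With a sum modulo 2 over the coordinates, a shift along one axis changes one summand only.
-- Recurrence along an axis then holds for all values of the other coordinates, as is needed to glue
-- whole faces of a box.
toeplitzᵛ : ∀ {n} → 2^ℤ^ n
toeplitzᵛ []      = false
toeplitzᵛ (z ∷ v) = toeplitz z xor toeplitzᵛ v

xor-interchange : ∀ a b c d → (a xor b) xor (c xor d) ≡ (a xor c) xor (b xor d)
xor-interchange = interchange

xor-cancel : ∀ b c → (b xor c) xor c ≡ b
xor-cancel b c = trans (Bool.xor-assoc b c c) (trans (cong (b xor_) (Bool.xor-same c)) (Bool.xor-identityʳ b))

toeplitzᵛ-toggles : ∀ {n} (g : ℤ^ n) → g ≢ 0ᵛ → Toggles toeplitzᵛ g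
toeplitzᵛ-toggles []      []≢[] = contradiction refl []≢[]
toeplitzᵛ-toggles (z ∷ g) g≢0 with z ℤ.≟ 0ℤ
... | yes refl with N , toggle ← toeplitzᵛ-toggles g (g≢0 ∘ cong (0ℤ ∷_)) = N , λ where
  (k ∷ h) b → let t , t≤N , eq = toggle h b
                  a = toeplitz (0ℤ ℤ.+ k)
              in 0ℤ ∷ t , t≤N , trans (xor-interchange a (toeplitzᵛ (t +ᵛ h)) a _)
                   (trans (cong (_xor _) (Bool.xor-same a)) eq)
toeplitzᵛ-toggles {suc n} (z ∷ g) g≢0 | no z≢0 with N , toggle ← toeplitz-toggles z z≢0 = N , λ where
  -- Only the first coordinate of the translate varies, so the other coordinates contribute the
  -- fixed bit `c`; asking the first one for `b xor c` cancels it.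
  (k ∷ h) b → let c  = toeplitzᵛ (0ᵛ +ᵛ h) xor toeplitzᵛ ((0ᵛ +ᵛ g) +ᵛ h)
                  t , t≤N , eq = toggle k (b xor c)
              in t ∷ 0ᵛ , ℕ.≤-trans (ℕ.≤-reflexive (∥axis∥ {suc n} zero t)) t≤N ,
                 trans (xor-interchange (toeplitz (t ℤ.+ k)) (toeplitzᵛ (0ᵛ +ᵛ h)) _ _)
                   (trans (cong (_xor c) eq) (xor-cancel b c))

toeplitzᵛ-recurrent : ∀ {n} k i (v : ℤ^ n) → ∣ lookup v i ∣ < 5 ^ k →
                      toeplitzᵛ (v +ᵛ axis i (+ (5 ^ k))) ≡ toeplitzᵛ v
toeplitzᵛ-recurrent k zero    (z ∷ v) z< =
  cong₂ _xor_ (toeplitz-recurrent k z z<) (cong toeplitzᵛ (+ᵛ-identityʳ v))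
toeplitzᵛ-recurrent k (suc i) (z ∷ v) v< =
  cong₂ _xor_ (cong toeplitz (ℤ.+-identityʳ z)) (toeplitzᵛ-recurrent k i v v<)

-- Uniform aperiodicity, which unlike freeness passes to limits of translates.
Hyperaperiodic : ∀ {n} → 2^ℤ^ n → Set
Hyperaperiodic {n} x = ∀ g → g ≢ 0ᵛ →
  Σ[ N ∈ ℕ ] (∀ h → Σ[ t ∈ ℤ^ n ] ∥ t ∥ ≤ N × x (t +ᵛ h) ≢ x ((t +ᵛ g) +ᵛ h))

xor≡true⇒≢ : ∀ {a b} → a xor b ≡ true → a ≢ b
xor≡true⇒≢ {a} eq refl = contradiction (trans (sym (Bool.xor-same a)) eq) λ ()

toeplitzᵛ-hyperaperiodic : ∀ {n} → Hyperaperiodic (toeplitzᵛ {n})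
toeplitzᵛ-hyperaperiodic g g≢0 with N , toggle ← toeplitzᵛ-toggles g g≢0 =
  N , λ h → let t , t≤N , eq = toggle h true in t , t≤N , xor≡true⇒≢ eq

-- Limits of translates and compactness

module _ {n : ℕ} where

  -- Every translate of `x` shows within the same distance `N` of the origin that `g` moves it, so
  -- an approximation of `y` on radius `N + ∥ g ∥` already contains the evidence.
  limit-free : ∀ {x y : 2^ℤ^ n} → Hyperaperiodic x → (∀ r → Σ[ g ∈ ℤ^ n ] Agree r y (g · x)) → IsFree y
  limit-free {x} {y} hyper approx g g≢0 gy≗y
    with N , differ ← hyper g g≢0
    with u , y~ux ← approx (N + ∥ g ∥)
    with t , t≤N , x≢ ← differ u =
    x≢ (begin
      x (t +ᵛ u)          ≡⟨ y~ux t (ℕ.≤-trans t≤N (ℕ.m≤m+n N _)) ⟨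
      y t                 ≡⟨ gy≗y t ⟨
      y (t +ᵛ g)          ≡⟨ y~ux (t +ᵛ g) (ℕ.≤-trans (∥∥-triangle t g) (ℕ.+-monoˡ-≤ _ t≤N)) ⟩
      x ((t +ᵛ g) +ᵛ u)   ∎)
    where open ≡-Reasoning

  hyperaperiodic-free : ∀ {x : 2^ℤ^ n} → Hyperaperiodic x → IsFree x
  hyperaperiodic-free {x} hyper = limit-free {x} {x} hyper λ _ → 0ᵛ , λ h _ → cong x (sym (+ᵛ-identityʳ h))

  module Compactness (em : ExcludedMiddle 0ℓ) where

    open Classical em

    Infinite : (ℕ → Set) → Set
    Infinite S = ∀ m → Σ[ M ∈ ℕ ] m ≤ M × S M

    module _ (z : ℕ → 2^ℤ^ n) where

      Coherent : (ℕ → Set) → ℤ^ n → Set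
      Coherent S h = ∀ {k l} → S k → S l → z k h ≡ z l h

      -- Infinite sets of indices stand in for subsequences, so nothing has to be re-enumerated when
      -- the values on a further ball are fixed.
      record Refinement (S : ℕ → Set) (P : ℤ^ n → Set) : Set₁ where
        constructor refinement
        field
          carrier  : ℕ → Set
          infinite : Infinite carrier
          subset   : ∀ {k} → carrier k → S k
          coherent : ∀ {h} → P h → Coherent carrier h

      open Refinement

      refine₁ : ∀ S → Infinite S → ∀ h → Refinement S (h ≡_)
      refine₁ S inf h with em {Infinite (λ k → S k × z k h ≡ true)}
      ... | yes inf-true = refinement _ inf-true proj₁ λ where refl (_ , p) (_ , q) → trans p (sym q)
      ... | no fin-true = refinement (λ k → S k × z k h ≡ false) inf-false proj₁
        λ where refl (_ , p) (_ , q) → trans p (sym q)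
        where
        last : Σ[ m ∈ ℕ ] (∀ k → m ≤ k → S k → z k h ≢ true)
        last = byContradiction λ none → fin-true λ m → byContradiction λ none′ →
          none (m , λ k m≤k Sk zk → none′ (k , m≤k , Sk , zk))
        inf-false : Infinite (λ k → S k × z k h ≡ false)
        inf-false m with k , m≤k , Sk ← inf (m ⊔ proj₁ last) =
          k , ℕ.≤-trans (ℕ.m≤m⊔n _ _) m≤k , Sk ,
          Bool.¬-not (proj₂ last k (ℕ.≤-trans (ℕ.m≤n⊔m m _) m≤k) Sk)

      refine : ∀ S → Infinite S → ∀ L → Refinement S (_∈ L)
      refine S inf []      = refinement S inf (λ Sk → Sk) λ ()
      refine S inf (h ∷ L)
        with R₁ ← refine₁ S inf h
        with R₂ ← refine (carrier R₁) (infinite R₁) L =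
        refinement (carrier R₂) (infinite R₂) (subset R₁ ∘ subset R₂) λ where
          (here refl)  p q → coherent R₁ refl (subset R₂ p) (subset R₂ q)
          (there h∈L) p q → coherent R₂ h∈L p q

      mutual
        stage : ℕ → ℕ → Set
        stage zero    k = ⊤
        stage (suc r)   = carrier (refinements r)

        stage-infinite : ∀ r → Infinite (stage r)
        stage-infinite zero    m = m , ℕ.≤-refl , tt
        stage-infinite (suc r)   = infinite (refinements r)

        refinements : ∀ r → Refinement (stage r) (_∈ ball n r)
        refinements r = refine (stage r) (stage-infinite r) (ball n r)

      element : ∀ r → Σ[ k ∈ ℕ ] stage r k
      element r with k , _ , Sk ← stage-infinite r 0 = k , Sk

      stage-antitone : ∀ d r {k} → stage (d + r) k → stage r k
      stage-antitone zero    r Sk = Sk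
      stage-antitone (suc d) r Sk = stage-antitone d r (subset (refinements (d + r)) Sk)

      stage-coherent : ∀ r h → ∥ h ∥ ≤ r → Coherent (stage (suc r)) h
      stage-coherent r h h≤r = coherent (refinements r) (∈-ball h h≤r)

      -- A diagonal choice: all indices in stage `suc ∥ h ∥` agree at `h`, so the chosen element
      -- does not matter.
      limit : 2^ℤ^ n
      limit h = z (proj₁ (element (suc ∥ h ∥))) h

      limit-approximated : ∀ r m → Σ[ k ∈ ℕ ] m ≤ k × Agree r limit (z k)
      limit-approximated r m with k , m≤k , Sk ← stage-infinite (suc r) m = k , m≤k , λ h h≤r →
        stage-coherent ∥ h ∥ h ℕ.≤-refl (proj₂ (element (suc ∥ h ∥)))
          (stage-antitone (r ∸ ∥ h ∥) (suc ∥ h ∥)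
            (subst (λ s → stage s k) (sym (trans (ℕ.+-suc (r ∸ ∥ h ∥) ∥ h ∥) (cong suc (ℕ.m∸n+n≡m h≤r)))) Sk))

    -- On the orbit of a hyperaperiodic point, whose closure is compact and
    -- free, a locally constant function reads a window of fixed size.
    uniform-window : ∀ {X : Set} {f : F n → X} → LocallyConstant f → ∀ (x : F n) → Hyperaperiodic (proj₁ x) →
      Σ[ M ∈ ℕ ] (∀ g h → Agree M (g · proj₁ x) (h · proj₁ x) → f (g ·ᶠ x) ≡ f (h ·ᶠ x))
    uniform-window {f = f} lc x hyper = byContradiction λ none → absurd (bad none)
      where
      Bad : ℕ → Set
      Bad M = Σ[ g ∈ ℤ^ n ] Σ[ h ∈ ℤ^ n ]
        Agree M (g · proj₁ x) (h · proj₁ x) × f (g ·ᶠ x) ≢ f (h ·ᶠ x)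

      bad : ¬ (Σ[ M ∈ ℕ ] (∀ g h → Agree M (g · proj₁ x) (h · proj₁ x) → f (g ·ᶠ x) ≡ f (h ·ᶠ x))) →
            ∀ M → Bad M
      bad none M = byContradiction λ none′ → none (M , λ g h agree →
        byContradiction λ f≢ → none′ (g , h , agree , f≢))

      absurd : ¬ (∀ M → Bad M)
      -- The limit of the bad translates is free, so `f` is constant on its neighbourhood of some
      -- radius `r`. A bad pair with `r ≤ M` and first member in that neighbourhood has its second
      -- member there too.
      absurd bad = f≢ (trans (proj₂ (lc yᶠ) (g ·ᶠ x) y~gx) (sym (proj₂ (lc yᶠ) (h ·ᶠ x) y~hx)))
        where
        z : ℕ → 2^ℤ^ n
        z M = proj₁ (bad M) · proj₁ x

        yᶠ : F n
        yᶠ = limit z , limit-free {proj₁ x} hyper λ r →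
          let k , _ , y~zk = limit-approximated z r 0 in proj₁ (bad k) , y~zk

        r : ℕ
        r = proj₁ (lc yᶠ)

        approximation : Σ[ M ∈ ℕ ] r ≤ M × Agree r (limit z) (z M)
        approximation = limit-approximated z r r

        M : ℕ
        M = proj₁ approximation

        g h : ℤ^ n
        g = proj₁ (bad M)
        h = proj₁ (proj₂ (bad M))

        f≢ : f (g ·ᶠ x) ≢ f (h ·ᶠ x)
        f≢ = proj₂ (proj₂ (proj₂ (bad M)))

        y~gx : Agree r (limit z) (g · proj₁ x)
        y~gx = proj₂ (proj₂ approximation)

        y~hx : Agree r (limit z) (h · proj₁ x)
        y~hx k k≤r = trans (y~gx k k≤r)
          (proj₁ (proj₂ (proj₂ (bad M))) k (ℕ.≤-trans k≤r (proj₁ (proj₂ approximation))))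

-- Parity on the torus

-- The points moved up and the points moved down by an involution are
-- equinumerous.
involution-even : ∀ {m} (f : Fin m → Fin m) → (∀ i → f (f i) ≡ i) → (∀ i → f i ≢ i) → Σ[ k ∈ ℕ ] m ≡ 2 * k
involution-even {m} f involutive moves = sum ups , (begin
  m                                  ≡⟨ sum-1 m ⟨
  sum {m} (λ _ → 1)                  ≡⟨ sum-cong-≗ ups+downs ⟨
  sum (λ i → ups i + ups (f i))      ≡⟨ ∑-distrib-+ ups (ups ∘ f) ⟩
  sum ups + sum (ups ∘ f)            ≡⟨ cong (λ k → sum ups + k) (sum-permute ups (permutation f f involutive involutive)) ⟨
  sum ups + sum ups                  ≡⟨ cong (λ k → sum ups + k) (ℕ.+-identityʳ _) ⟨
  2 * sum ups                        ∎)
  where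
  open ≡-Reasoning
  bit : Bool → ℕ
  bit b = if b then 1 else 0

  ups : Fin m → ℕ
  ups i = bit (does (i Fin.<? f i))

  sum-1 : ∀ k → sum {k} (λ _ → 1) ≡ k
  sum-1 zero    = refl
  sum-1 (suc k) = cong suc (sum-1 k)

  compare : ∀ (i j : Fin m) → j ≢ i → bit (does (i Fin.<? j)) + bit (does (j Fin.<? i)) ≡ 1
  compare i j j≢i with Fin.<-cmp i j
  ... | tri< i<j _ j≮i = cong₂ (λ a b → bit a + bit b) (dec-true (i Fin.<? j) i<j) (dec-false (j Fin.<? i) j≮i)
  ... | tri≈ _ i≡j _   = contradiction (sym i≡j) j≢i
  ... | tri> i≮j _ j<i = cong₂ (λ a b → bit a + bit b) (dec-false (i Fin.<? j) i≮j) (dec-true (j Fin.<? i) j<i)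

  ups+downs : ∀ i → ups i + ups (f i) ≡ 1
  ups+downs i = trans (cong (λ j → ups i + bit (does (f i Fin.<? j))) (involutive i)) (compare i (f i) (moves i))

odd-^ : ∀ q n → Σ[ p ∈ ℕ ] suc (2 * q) ^ n ≡ suc (2 * p)
odd-^ q zero    = 0 , refl
odd-^ q (suc n) with p , eq ← odd-^ q n =
  p + q * suc (2 * p) , trans (cong (suc (2 * q) *_) eq) (expand q p)
  where
  expand : ∀ q p → suc (2 * q) * suc (2 * p) ≡ suc (2 * (p + q * suc (2 * p)))
  expand = ℕ-Solver.solve-∀

Vec↔Fin : ∀ L n → Vec (Fin L) n ↔ Fin (L ^ n)
Vec↔Fin L n = mk↔ₛ′ (encode n) (decode n) (encode-decode n) (decode-encode n)
  where
  encode : ∀ n → Vec (Fin L) n → Fin (L ^ n)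
  encode zero    []      = zero
  encode (suc n) (j ∷ v) = combine j (encode n v)

  decode : ∀ n → Fin (L ^ n) → Vec (Fin L) n
  decode zero    _ = []
  decode (suc n) k = proj₁ (remQuot {L} (L ^ n) k) ∷ decode n (proj₂ (remQuot {L} (L ^ n) k))

  encode-decode : ∀ n (k : Fin (L ^ n)) → encode n (decode n k) ≡ k
  encode-decode zero    zero = refl
  encode-decode (suc n) k = trans
    (cong (combine (proj₁ (remQuot {L} (L ^ n) k))) (encode-decode n (proj₂ (remQuot {L} (L ^ n) k))))
    (Fin.combine-remQuot {L} (L ^ n) k)

  decode-encode : ∀ n (v : Vec (Fin L) n) → decode n (encode n v) ≡ v
  decode-encode zero    []      = refl
  decode-encode (suc n) (j ∷ v) = trans
    (cong (λ (i , k) → i ∷ decode n k) (Fin.remQuot-combine j (encode n v)))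
    (cong (j ∷_) (decode-encode n v))

-- A step along a coordinate axis of ℤⁿ, forwards (true) or backwards (false).
Step : ℕ → Set
Step n = Bool × Fin n

unit : Bool → ℤ
unit true  = 1ℤ
unit false = -1ℤ

vector : ∀ {n} → Step n → ℤ^ n
vector (b , i) = axis i (unit b)

opposite : ∀ {n} → Step n → Step n
opposite (b , i) = not b , i

module Cycle (m : ℕ) where

  next prev : Fin (suc m) → Fin (suc m)
  next j with view j
  ... | ‵fromℕ     = zero
  ... | ‵inject₁ i = suc i
  prev zero    = fromℕ m
  prev (suc i) = inject₁ i

  next-fromℕ : next (fromℕ m) ≡ zero
  next-fromℕ rewrite view-fromℕ m = refl

  next-inject₁ : ∀ i → next (inject₁ i) ≡ suc i
  next-inject₁ i rewrite view-inject₁ i = refl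

  rotate : Bool → Fin (suc m) → Fin (suc m)
  rotate true  = next
  rotate false = prev

  rotate-inverse : ∀ b j → rotate (not b) (rotate b j) ≡ j
  rotate-inverse true j with view j
  ... | ‵fromℕ     = refl
  ... | ‵inject₁ i = refl
  rotate-inverse false zero    = next-fromℕ
  rotate-inverse false (suc i) = next-inject₁ i

  data Rotation (b : Bool) (j : Fin (suc m)) : Set where
    inside : + toℕ (rotate b j) ≡ unit b ℤ.+ + toℕ j → Rotation b j
    top    : b ≡ true → toℕ j ≡ m → toℕ (rotate b j) ≡ 0 → Rotation b j
    bottom : b ≡ false → toℕ j ≡ 0 → toℕ (rotate b j) ≡ m → Rotation b j

  rotation : ∀ b j → Rotation b j
  rotation true j with view j in eq
  ... | ‵fromℕ     = top refl (Fin.toℕ-fromℕ m) (cong toℕ next-fromℕ)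
  ... | ‵inject₁ i = inside (trans (cong (+_ ∘ toℕ) (next-inject₁ i)) (cong (λ k → + suc k) (sym (Fin.toℕ-inject₁ i))))
  rotation false zero    = bottom refl refl (Fin.toℕ-fromℕ m)
  rotation false (suc i) = inside (cong +_ (Fin.toℕ-inject₁ i))

  rotate-moves : 0 < m → ∀ b j → rotate b j ≢ j
  rotate-moves 0<m b j eq with rotation b j
  ... | inside p = no-shift b (trans (sym p) (cong (+_ ∘ toℕ) eq))
    where
    no-shift : ∀ b {z} → unit b ℤ.+ z ≢ z
    no-shift true  {z} p = contradiction (∙-cancelʳ z 1ℤ 0ℤ (trans p (sym (ℤ.+-identityˡ z)))) λ ()
    no-shift false {z} p = contradiction (∙-cancelʳ z -1ℤ 0ℤ (trans p (sym (ℤ.+-identityˡ z)))) λ ()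
  ... | top _ j≡m r≡0 = ℕ.<⇒≢ 0<m (trans (sym r≡0) (trans (cong toℕ eq) j≡m))
  ... | bottom _ j≡0 r≡m = ℕ.<⇒≢ 0<m (trans (sym j≡0) (trans (sym (cong toℕ eq)) r≡m))

module Torus {n : ℕ} (m : ℕ) (0<m : 0 < m) (s : ℤ^ n → Step n)
  (matching : ∀ g → s (vector (s g) +ᵛ g) ≡ opposite (s g))
  (periodic : ∀ g i → ∣ lookup g i ∣ ≤ 1 → s (g +ᵛ axis i (+ suc m)) ≡ s g)
  where

  open Cycle m

  embed : ∀ {n} → Vec (Fin (suc m)) n → ℤ^ n
  embed = Vec.map (+_ ∘ toℕ)

  embed-updateAt : ∀ {n} (v : Vec (Fin (suc m)) n) i {f t} →
    + toℕ (f (lookup v i)) ≡ t ℤ.+ + toℕ (lookup v i) → embed (updateAt v i f) ≡ axis i t +ᵛ embed v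
  embed-updateAt (j ∷ v) zero    eq = cong₂ _∷_ eq (sym (+ᵛ-identityˡ (embed v)))
  embed-updateAt (j ∷ v) (suc i) eq = cong₂ _∷_ (sym (ℤ.+-identityˡ (+ toℕ j))) (embed-updateAt v i eq)

  move : Vec (Fin (suc m)) n → Vec (Fin (suc m)) n
  move v = let b , i = s (embed v) in updateAt v i (rotate b)

  private
    wrapped : ∀ (v w : ℤ^ n) i a b → v ≡ axis i a +ᵛ w → v +ᵛ axis i b ≡ axis i (b ℤ.+ a) +ᵛ w
    wrapped v w i a b refl = begin
      (axis i a +ᵛ w) +ᵛ axis i b   ≡⟨ +ᵛ-comm (axis i a +ᵛ w) (axis i b) ⟩
      axis i b +ᵛ (axis i a +ᵛ w)   ≡⟨ +ᵛ-assoc (axis i b) (axis i a) w ⟨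
      (axis i b +ᵛ axis i a) +ᵛ w   ≡⟨ cong (_+ᵛ w) (axis-+ i b a) ⟩
      axis i (b ℤ.+ a) +ᵛ w         ∎
      where open ≡-Reasoning

  -- Inside the box a move is a step in the lattice. Across the seam the torus neighbour and the
  -- lattice neighbour differ by `suc m` along `i`, and the lower of the two has coordinate 0
  -- (`top`) or -1 (`bottom`); hence `periodic` is required only for coordinates of size at most 1.
  step-back : ∀ v → s (embed (move v)) ≡ opposite (s (embed v))
  step-back v with s (embed v) in sv
  ... | b , i with rotation b (lookup v i)
  ...   | inside p = trans (cong s (embed-updateAt v i p)) back
    where
    back : s (axis i (unit b) +ᵛ embed v) ≡ opposite (b , i)
    back = subst (λ l → s (vector l +ᵛ embed v) ≡ opposite l) sv (matching (embed v))
  ...   | top refl j≡m r≡0 = begin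
    s u                          ≡⟨ periodic u i (ℕ.≤-trans (ℕ.≤-reflexive (cong ∣_∣ u-i)) z≤n) ⟨
    s (u +ᵛ axis i (+ suc m))    ≡⟨ cong s (wrapped u (embed v) i (ℤ.- + m) (+ suc m) (embed-updateAt v i shift)) ⟩
    s (axis i (+ suc m ℤ.- + m) +ᵛ embed v) ≡⟨ cong (λ z → s (axis i z +ᵛ embed v)) one ⟩
    s (axis i 1ℤ +ᵛ embed v)     ≡⟨ subst (λ l → s (vector l +ᵛ embed v) ≡ opposite l) sv (matching (embed v)) ⟩
    false , i                    ∎
    where
    open ≡-Reasoning
    u : ℤ^ n
    u = embed (updateAt v i next)
    u-i : lookup u i ≡ 0ℤ
    u-i = trans (lookup-map i (+_ ∘ toℕ) (updateAt v i next))
      (trans (cong (+_ ∘ toℕ) (lookup∘updateAt i v)) (cong +_ r≡0))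
    shift : + toℕ (next (lookup v i)) ≡ ℤ.- + m ℤ.+ + toℕ (lookup v i)
    shift = trans (cong +_ r≡0) (sym (trans (cong (λ k → ℤ.- + m ℤ.+ + k) j≡m) (ℤ.+-inverseˡ (+ m))))
    one : + suc m ℤ.- + m ≡ 1ℤ
    one = trans (ℤ.m-n≡m⊖n (suc m) m) (trans (ℤ.⊖-≥ (ℕ.n≤1+n m)) (cong +_ (ℕ.m+n∸n≡m 1 m)))
  ...   | bottom refl j≡0 r≡m = begin
    s (embed (updateAt v i prev))                ≡⟨ cong s (trans (embed-updateAt v i shift) (sym (wrapped w (embed v) i -1ℤ (+ suc m) refl))) ⟩
    s (w +ᵛ axis i (+ suc m))                    ≡⟨ periodic w i (ℕ.≤-reflexive (cong ∣_∣ w-i)) ⟩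
    s w                                          ≡⟨ subst (λ l → s (vector l +ᵛ embed v) ≡ opposite l) sv (matching (embed v)) ⟩
    true , i                                     ∎
    where
    open ≡-Reasoning
    w : ℤ^ n
    w = axis i -1ℤ +ᵛ embed v
    w-i : lookup w i ≡ -1ℤ
    w-i = trans (lookup-+ᵛ i (axis i -1ℤ) (embed v)) (cong₂ ℤ._+_ (lookup-axis i -1ℤ)
      (trans (lookup-map i (+_ ∘ toℕ) v) (cong +_ j≡0)))
    shift : + toℕ (prev (lookup v i)) ≡ (+ suc m ℤ.+ -1ℤ) ℤ.+ + toℕ (lookup v i)
    shift = trans (cong +_ r≡m) (sym (trans (cong (λ k → + m ℤ.+ + k) j≡0) (ℤ.+-identityʳ (+ m))))

  move-involutive : ∀ v → move (move v) ≡ v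
  move-involutive v = trans
    (cong (λ l → updateAt (move v) (proj₂ l) (rotate (proj₁ l))) (step-back v))
    (trans (updateAt-updateAt i v) (updateAt-id-local i v (rotate-inverse b (lookup v i))))
    where
    b : Bool
    b = proj₁ (s (embed v))
    i : Fin n
    i = proj₂ (s (embed v))

  move-moves : ∀ v → move v ≢ v
  move-moves v eq = rotate-moves 0<m b (lookup v i)
    (trans (sym (lookup∘updateAt i v)) (cong (λ u → lookup u i) eq))
    where
    b : Bool
    b = proj₁ (s (embed v))
    i : Fin n
    i = proj₂ (s (embed v))

  torus-even : Σ[ k ∈ ℕ ] suc m ^ n ≡ 2 * k
  torus-even = involution-even (to ∘ move ∘ from)
    (λ k → trans (cong (to ∘ move) (strictlyInverseʳ (move (from k))))
      (trans (cong to (move-involutive (from k))) (strictlyInverseˡ k)))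
    (λ k eq → move-moves (from k) (trans (sym (strictlyInverseʳ _)) (cong from eq)))
    where open Inverse (Vec↔Fin (suc m) n)

-- No coloring with 2n colors

unit≢0 : ∀ b → unit b ≢ 0ℤ
unit≢0 true  ()
unit≢0 false ()

unit-injective : ∀ a b → unit a ≡ unit b → a ≡ b
unit-injective true  true  _ = refl
unit-injective false false _ = refl

unit-not : ∀ b → unit (not b) ℤ.+ unit b ≡ 0ℤ
unit-not true  = refl
unit-not false = refl

opposite-vector : ∀ {n} (l : Step n) → vector (opposite l) +ᵛ vector l ≡ 0ᵛ
opposite-vector (b , i) = trans (axis-+ i (unit (not b)) (unit b)) (trans (cong (axis i) (unit-not b)) (axis-0 i))

vector-injective : ∀ {n} {k l : Step n} → vector k ≡ vector l → k ≡ l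
vector-injective {k = a , i} {b , j} eq = cong₂ _,_ (unit-injective a b signs) i≡j
  where
  i≡j : i ≡ j
  i≡j with i Fin.≟ j
  ... | yes p = p
  ... | no i≢j = contradiction
    (trans (sym (lookup-axis i (unit a))) (trans (cong (λ v → lookup v i) eq) (lookup-axis′ i≢j (unit b))))
    (unit≢0 a)
  signs : unit a ≡ unit b
  signs = begin
    unit a                      ≡⟨ lookup-axis i (unit a) ⟨
    lookup (axis i (unit a)) i  ≡⟨ cong (λ v → lookup v i) eq ⟩
    lookup (axis j (unit b)) i  ≡⟨ cong (λ k → lookup (axis j (unit b)) k) i≡j ⟩
    lookup (axis j (unit b)) j  ≡⟨ lookup-axis j (unit b) ⟩
    unit b                      ∎
    where open ≡-Reasoning

generator : ∀ {n} (l : Step n) → IsGenerator (vector l)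
generator (true  , i) = i , inj₁ refl
generator (false , i) = i , inj₂ (sym (axis-neg i 1ℤ))

m<5^m : ∀ m → m < 5 ^ m
m<5^m zero    = s≤s z≤n
m<5^m (suc m) = begin-strict
  suc m          ≤⟨ m<5^m m ⟩
  5 ^ m          <⟨ ℕ.m<m*n (5 ^ m) 5 {{ℕ.m^n≢0 5 m}} (s≤s (s≤s z≤n)) ⟩
  5 ^ m * 5      ≡⟨ ℕ.*-comm (5 ^ m) 5 ⟩
  5 * 5 ^ m      ∎
  where open ℕ.≤-Reasoning

module _ {n : ℕ} {κ : Set} (c : EdgeColoring (Schreier n) κ) (proper : IsProper (Schreier n) c) where

  open EdgeColoring c

  colorAlong : F n → Step n → κ
  colorAlong x l = color (edge (vector l) (generator l) x)

  colorAlong-injective : ∀ x {k l} → colorAlong x k ≡ colorAlong x l → k ≡ l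
  colorAlong-injective x {k} {l} eq with Product.≡-dec Bool._≟_ Fin._≟_ k l
  ... | yes k≡l = k≡l
  ... | no k≢l = contradiction eq (proper (edge (vector k) (generator k) x) (edge (vector l) (generator l) x)
    distinct (x , inj₁ (λ _ → refl) , inj₁ (λ _ → refl)))
    where
    distinct : ¬ (_≈ᴱ_ (Schreier n) (edge (vector k) (generator k) x) (edge (vector l) (generator l) x))
    distinct (inj₁ (_ , kx≗lx)) = k≢l (vector-injective (·-injective {g = vector k} {vector l} x kx≗lx))
    distinct (inj₂ (x≗lx , _)) = generator≢0 (generator l)
      (·-injective {g = vector l} {0ᵛ} x (λ h → trans (sym (x≗lx h)) (sym (·-identity x h))))

  colorAlong-opposite : ∀ x l → colorAlong (vector l ·ᶠ x) (opposite l) ≡ colorAlong x l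
  colorAlong-opposite x l = color-cong (inj₂ ((λ _ → refl) , λ h → begin
    proj₁ x ((h +ᵛ vector (opposite l)) +ᵛ vector l)   ≡⟨ ·-assoc (vector (opposite l)) (vector l) x h ⟩
    proj₁ x (h +ᵛ (vector (opposite l) +ᵛ vector l))   ≡⟨ cong (λ v → proj₁ x (h +ᵛ v)) (opposite-vector l) ⟩
    proj₁ x (h +ᵛ 0ᵛ)                                  ≡⟨ ·-identity x h ⟩
    proj₁ x h                                          ∎))
    where open ≡-Reasoning

  -- The `2 * n` edges at `x` have distinct colors and `α` is one more. The index set is again a
  -- step or one extra element, so `palette` is reused to count it.
  missing-color : ∀ x α → (∀ l → colorAlong x l ≢ α) → Fin (2 * n + 1) ↣ κ
  missing-color x α missing = mk↣ {to = to} λ {i} {j} eq →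
    ↔-injective (↔-sym (palette n)) (paint-injective _ _ eq)
    where
    paint : Color n → κ
    paint (inj₁ l) = colorAlong x l
    paint (inj₂ _) = α

    to : Fin (2 * n + 1) → κ
    to = paint ∘ Inverse.from (palette n)

    paint-injective : ∀ k l → paint k ≡ paint l → k ≡ l
    paint-injective (inj₁ k) (inj₁ l) eq = cong inj₁ (colorAlong-injective x eq)
    paint-injective (inj₁ k) (inj₂ _) eq = contradiction eq (missing k)
    paint-injective (inj₂ _) (inj₁ l) eq = contradiction (sym eq) (missing l)
    paint-injective (inj₂ zero) (inj₂ zero) eq = refl

  module PerfectMatching (em : ExcludedMiddle 0ℓ) (continuous : IsContinuousColoring c) (α : κ)
    (perfect : ∀ x → Σ[ l ∈ Step n ] colorAlong x l ≡ α)
    (x₀ : F n) (hyperaperiodic : Hyperaperiodic (proj₁ x₀))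
    (recurrent : ∀ k i v → ∣ lookup v i ∣ < 5 ^ k → proj₁ x₀ (v +ᵛ axis i (+ (5 ^ k))) ≡ proj₁ x₀ v) where

    open Compactness {n} em

    match : F n → Step n
    match x = proj₁ (perfect x)

    match-unique : ∀ x {l} → colorAlong x l ≡ α → match x ≡ l
    match-unique x eq = colorAlong-injective x (trans (proj₂ (perfect x)) (sym eq))

    -- By continuity along the matched generator, the same step still has color `α` at nearby
    -- points, and properness leaves no other step with that color.
    match-LC : LocallyConstant match
    match-LC x with r , p ← continuous⇒LC (continuous (vector (match x)) (generator (match x))) x =
      r , λ y x~y → match-unique y (trans (p y x~y) (proj₂ (perfect x)))

    match-opposite : ∀ x → match (vector (match x) ·ᶠ x) ≡ opposite (match x)
    match-opposite x = match-unique (vector (match x) ·ᶠ x) (trans (colorAlong-opposite x (match x)) (proj₂ (perfect x)))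

    matchAt : ℤ^ n → Step n
    matchAt g = match (g ·ᶠ x₀)

    matchAt-opposite : ∀ g → matchAt (vector (matchAt g) +ᵛ g) ≡ opposite (matchAt g)
    matchAt-opposite g = trans (sym (LC-shift² {f = match} match-LC (vector (matchAt g)) g x₀)) (match-opposite (g ·ᶠ x₀))

    window : Σ[ M ∈ ℕ ] (∀ g h → Agree M (g · proj₁ x₀) (h · proj₁ x₀) → matchAt g ≡ matchAt h)
    window = uniform-window {f = match} match-LC x₀ hyperaperiodic

    -- The window is enlarged by 1 because periodicity is used at coordinates of size up to 1;
    -- everything read then has size at most `M`, which is below `5 ^ M`.
    M L : ℕ
    M = suc (proj₁ window)
    L = 5 ^ M

    matchAt-periodic : ∀ g i → ∣ lookup g i ∣ ≤ 1 → matchAt (g +ᵛ axis i (+ L)) ≡ matchAt g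
    matchAt-periodic g i g≤1 = proj₂ window (g +ᵛ axis i (+ L)) g λ h h≤M → begin
      proj₁ x₀ (h +ᵛ (g +ᵛ axis i (+ L)))    ≡⟨ cong (proj₁ x₀) (+ᵛ-assoc h g _) ⟨
      proj₁ x₀ ((h +ᵛ g) +ᵛ axis i (+ L))    ≡⟨ recurrent M i (h +ᵛ g) (near h h≤M) ⟩
      proj₁ x₀ (h +ᵛ g)                      ∎
      where
      open ≡-Reasoning
      near : ∀ h → ∥ h ∥ ≤ proj₁ window → ∣ lookup (h +ᵛ g) i ∣ < L
      near h h≤M = ℕ.≤-<-trans (ℕ.≤-trans (ℕ.≤-reflexive (cong ∣_∣ (lookup-+ᵛ i h g)))
        (ℕ.≤-trans (ℤ.∣i+j∣≤∣i∣+∣j∣ (lookup h i) (lookup g i))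
          (ℕ.≤-trans (ℕ.+-mono-≤ (ℕ.≤-trans (∣lookup∣≤∥∥ h i) h≤M) g≤1)
            (ℕ.≤-reflexive (ℕ.+-comm (proj₁ window) 1)))))
        (m<5^m M)

    odd-period : ∀ q → L ≡ suc (2 * q) → ⊥
    odd-period q L≡ = ℕ.even≢odd (proj₁ torus-even) (proj₁ (odd-^ q n))
      (trans (sym (proj₂ torus-even)) (proj₂ (odd-^ q n)))
      where
      0<2q : 0 < 2 * q
      0<2q = ℕ.≤-pred (subst (2 ≤_) L≡ (ℕ.≤-trans (s≤s (s≤s z≤n)) (m<5^m M)))

      periodic : ∀ g i → ∣ lookup g i ∣ ≤ 1 → matchAt (g +ᵛ axis i (+ suc (2 * q))) ≡ matchAt g
      periodic g i g≤1 = subst (λ l → matchAt (g +ᵛ axis i (+ l)) ≡ matchAt g) L≡ (matchAt-periodic g i g≤1)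

      open Torus (2 * q) 0<2q matchAt matchAt-opposite periodic

    contradictory : ⊥
    contradictory = odd-period (proj₁ (odd-^ 2 M)) (proj₂ (odd-^ 2 M))

lower-bound : ExcludedMiddle 0ℓ → ∀ n → n ≥ 1 → ∀ κ → HasContinuousProperEdgeColoring n κ → Fin (2 * n + 1) ↣ κ
lower-bound em (suc n) _ κ (c , proper , continuous) = byContradiction λ none →
  -- Without `2 * n + 1` distinct colors, no color is absent at any vertex. Any color therefore
  -- gives a perfect matching, and `n ≥ 1` supplies an edge at `x₀` whose color can be taken.
  let perfect = λ α x → byContradiction λ missing →
        none (missing-color c proper x α λ l eq → missing (l , eq))
  in PerfectMatching.contradictory c proper em continuous
       (colorAlong c proper x₀ (true , zero)) (perfect (colorAlong c proper x₀ (true , zero)))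
       x₀ toeplitzᵛ-hyperaperiodic toeplitzᵛ-recurrent
  where
  open Classical em
  x₀ : F (suc n)
  x₀ = toeplitzᵛ , hyperaperiodic-free toeplitzᵛ-hyperaperiodic

corollary4p8 : ExcludedMiddle 0ℓ → (n : ℕ) → n ≥ 1 → χ′c[F n ]≡ (2 * n + 1)
corollary4p8 em n n≥1 = upper-bound em n , lower-bound em n n≥1
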